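{- There is an absolute constant $C>0$ such that for every integer $n\ge 2$, $$\Big|\max_{T}\mu_T-\big(n-2\log_2 n\big)\Big|\le C,$$ where the maximum is over all trees $T$ with $n$ vertices. In other words, the maximum of the mean subtree order over all trees with $n$ vertices is $n-2\log_2 n+O(1)$.
   Context: A subtree of a tree $T$ is a (nonempty) induced subgraph of $T$ that is connected, hence again a tree. The mean subtree order $\mu_T$ of $T$ is the average number of vertices of a subtree, averaged over all subtrees of $T$. -}

module Defs where

open import Data.Bool using (Bool; true; false; _∧_; if_then_else_)
open import Data.Nat using (ℕ; zero; suc; _∸_; _*_; _≤ᵇ_; _<ᵇ_; NonZero)
open import Data.Nat.Logarithm using (⌊log₂_⌋)
open import Data.Fin using (Fin; toℕ)
open import Data.Fin.Subset using (Subset; _∈_; Nonempty)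
open import Data.List using (List; map; allFin; length)
open import Data.Nat.ListAction using (sum)
open import Data.List.Relation.Unary.Unique.Propositional using (Unique)
import Data.List.Membership.Propositional as LM
open import Data.Integer using (+_)
open import Data.Rational using (ℚ; _/_; _-_) renaming (_*_ to _*ℚ_)
open import Data.Product using (Σ; _×_; ∃; ∃-syntax)
open import Function.Bundles using (_⇔_)
open import Relation.Binary.PropositionalEquality using (_≡_)

record Graph (n : ℕ) : Set where
  field
    adj    : Fin n → Fin n → Bool
    sym    : ∀ u v → adj u v ≡ adj v u
    irrefl : ∀ v → adj v v ≡ false
open Graph public

data Walk {n : ℕ} (G : Graph n) (S : Subset n) : Fin n → Fin n → Set where
  stay : ∀ {u} → u ∈ S → Walk G S u u
  step : ∀ {u w v} → u ∈ S → adj G u w ≡ true → Walk G S w v → Walk G S u v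

InducedConnected : {n : ℕ} → Graph n → Subset n → Set
InducedConnected G S = ∀ u v → u ∈ S → v ∈ S → Walk G S u v

full : (n : ℕ) → Subset n
full n = Data.Fin.Subset.⊤

edgeCount : {n : ℕ} → Graph n → ℕ
edgeCount {n} G =
  sum (map (λ u → sum (map (λ v → if adj G u v ∧ (toℕ u <ᵇ toℕ v) then 1 else 0)
                           (allFin n)))
           (allFin n))

IsTree : {n : ℕ} → Graph n → Set
IsTree {n} G = InducedConnected G (full n) × edgeCount G ≡ n ∸ 1

IsSubtree : {n : ℕ} → Graph n → Subset n → Set
IsSubtree G S = Nonempty S × InducedConnected G S

size : {n : ℕ} → Subset n → ℕ
size S = Data.Fin.Subset.∣ S ∣

ℕ→ℚ : ℕ → ℚ
ℕ→ℚ k = + k / 1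

MeanSubtreeOrder : {n : ℕ} → Graph n → ℚ → Set
MeanSubtreeOrder {n} T μ =
  ∃[ L ] (Unique L × (∀ S → (S LM.∈ L) ⇔ IsSubtree T S)
          × μ *ℚ ℕ→ℚ (length L) ≡ ℕ→ℚ (sum (map size L)))

target : ℕ → ℚ
target n = ℕ→ℚ n - ℕ→ℚ (2 * ⌊log₂ n ⌋)

{-# OPTIONS --safe #-}

-- Measure a subtree S by its deficit n − |S|.
--
-- Upper bound.  Root the tree at r, let a be the number of subtrees through r and d their total deficit.
-- The entropy of the uniform distribution on these subtrees is at most twice the mean deficit, which
-- reads a ^ a ≤ 4 ^ d.  Adding an edge above r increases the mean deficit by about n / a; so as long
-- as a is at most of order n² the mean deficit grows at least as fast as log₂ n, and for larger a the
-- entropy bound already gives log₂ n.  Hence d / a ≥ log₂ n − 3 for every rooted tree.  Now choose r so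
-- that the tree splits at r into two parts with at least n / 4 vertices each: mean deficits add up, so
-- the subtrees through r have mean deficit at least 2 log₂ n − O(1), and every other subtree misses
-- about n / 4 vertices at least.
--
-- Lower bound.  Take a path with 2 log₂ n leaves attached to each of its two ends.  The subtrees
-- containing the whole path number about n⁴ and have mean deficit 2 log₂ n, and the rest, of order n³,
-- change the mean deficit by O(1) only.
module Submission where

open import Defs hiding (sym; irrefl)
open import Data.Bool as Bool using (Bool; true; false; T; _∧_; if_then_else_)
open import Data.Bool.Properties using (T?; ∧-zeroʳ)
open import Data.Empty using (⊥)
open import Data.Fin using (Fin; zero; suc; toℕ)
import Data.Fin.Properties as Fin
open import Data.Fin.Subset using (Subset; inside; outside; _∈_; _∉_; _⊆_; _∪_; _∩_; ⁅_⁆; ∁; ⊤; Nonempty)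
open import Data.Fin.Subset.Properties
open import Data.Integer as ℤ using ()
import Data.Integer.Properties as ℤ
open import Data.List using (List; []; _∷_; _++_; map; length; filter; allFin; cartesianProduct; cartesianProductWith)
import Data.List.Membership.Propositional as LM
open import Data.List.Membership.Propositional.Properties
  using (∈-++⁺ˡ; ∈-++⁺ʳ; ∈-++⁻; ∈-∃++; ∈-map⁻; ∈-filter⁺;
         ∈-cartesianProduct⁺; ∈-cartesianProductWith⁺; ∈-cartesianProductWith⁻; ∈-allFin)
open import Data.List.Membership.Propositional.Properties.WithK using (unique∧set⇒bag)
open import Data.List.Properties using (map-++; length-++; length-map; filter-++; map-tabulate; map-cong)
open import Data.List.Relation.Binary.BagAndSetEquality using (∼bag⇒↭)
open import Data.List.Relation.Binary.Permutation.Propositional using (_↭_)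
import Data.List.Relation.Binary.Permutation.Propositional.Properties as Perm
open import Data.List.Relation.Unary.All as All using (All; []; _∷_)
open import Data.List.Relation.Unary.AllPairs using ([]; _∷_)
open import Data.List.Relation.Unary.Any using (here; there)
open import Data.List.Relation.Unary.Unique.Propositional using (Unique)
import Data.List.Relation.Unary.Unique.Propositional.Properties as Unique
open import Data.Nat
open import Data.Nat.Induction using (<-rec)
open import Data.Nat.ListAction using (sum)
open import Data.Nat.ListAction.Properties using (sum-++; sum-↭)
open import Data.Nat.Logarithm using (⌊log₂_⌋; ⌊log₂⌋-mono-≤; ⌊log₂⌊n/2⌋⌋≡⌊log₂n⌋∸1; ⌊log₂[2^n]⌋≡n)
open import Data.Nat.Properties
open import Data.Nat.Tactic.RingSolver using (solve-∀)
open import Data.Product using (_×_; _,_; proj₁; proj₂; ∃-syntax; Σ-syntax)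
open import Data.Rational as ℚ using (ℚ; toℚᵘ)
import Data.Rational.Properties as ℚ
open import Data.Rational.Unnormalised as ℚᵘ using (mkℚᵘ; *≡*; *≤*)
import Data.Rational.Unnormalised.Properties as ℚᵘ
open import Data.Sum using (_⊎_; inj₁; inj₂)
open import Data.Vec using ([]; _∷_; here; there)
open import Function.Base using (_∘_; id)
open import Function.Bundles using (_⇔_; mk⇔; Equivalence)
open import Relation.Binary using (tri<; tri≈; tri>)
open import Relation.Binary.PropositionalEquality
open import Relation.Nullary using (Dec; yes; no; does; ¬?; contradiction; _×-dec_)

-- The threshold n² comes from comparing two gains: one more edge raises log₂ n by about 1 / n and
-- the mean deficit by about n / a, which suffices while a is at most of order n². Beyond that, the
-- factor two of the entropy bound matches the square, since log₂ a is at most twice the mean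
-- deficit. What makes inductions on trees work is independence. A branch `t` below the root is a
-- choice among `suc (rooted t)` options, the extra one being the empty branch of deficit `order t`.
-- Hence logarithms of counts add, and so do mean deficits. Inequalities between such quantities are
-- exponentiated and cleared of denominators, so that the combinatorics stays in ℕ. Constants: each
-- side of the balanced split loses 2 for having only a quarter of the vertices and 3 for the factor
-- 8 in `LogBound`, hence 10 in the upper bound. The lower bound loses 6 for the subtrees through
-- the root of the baton and 24 for the others, and 30 serves for both directions. `IsTree` speaks
-- of connectedness and an edge count only; `Decomposition` is the bridge from graphs to the
-- recursive counts.

-- Rooted trees and their subtree counts

-- s ◁ t makes the root of t a new child of the root of s.
data RTree : Set where
  ∙   : RTree
  _◁_ : RTree → RTree → RTree

infixl 6 _◁_

-- rooted, rootedSum and deficit count the subtrees through the root, their vertices and the vertices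
-- they miss; inner and innerSum count the subtrees avoiding the root and their vertices.
order rooted rootedSum deficit inner innerSum : RTree → ℕ

order ∙       = 1
order (s ◁ t) = order s + order t

rooted ∙       = 1
rooted (s ◁ t) = rooted s * suc (rooted t)

rootedSum ∙       = 1
rootedSum (s ◁ t) = rootedSum s + (rooted t * rootedSum s + rooted s * rootedSum t)

deficit ∙       = 0
deficit (s ◁ t) = suc (rooted t) * deficit s + rooted s * (deficit t + order t)

inner ∙       = 0
inner (s ◁ t) = inner s + (inner t + rooted t)

innerSum ∙       = 0
innerSum (s ◁ t) = innerSum s + (innerSum t + rootedSum t)

order>0 : ∀ t → 1 ≤ order t
order>0 ∙       = ≤-refl
order>0 (s ◁ t) = ≤-trans (order>0 s) (m≤m+n _ _)

rooted>0 : ∀ t → 1 ≤ rooted t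
rooted>0 ∙       = ≤-refl
rooted>0 (s ◁ t) = *-mono-≤ (rooted>0 s) (s≤s (z≤n {rooted t}))

rootedSum+deficit : ∀ t → rootedSum t + deficit t ≡ order t * rooted t
rootedSum+deficit ∙       = refl
rootedSum+deficit (s ◁ t) = begin
  rootedSum s + (rooted t * rootedSum s + rooted s * rootedSum t)
    + (suc (rooted t) * deficit s + rooted s * (deficit t + order t))
    ≡⟨ lem (rootedSum s) (rooted t) (rooted s) (rootedSum t) (deficit s) (deficit t) (order t) ⟩
  suc (rooted t) * (rootedSum s + deficit s) + rooted s * ((rootedSum t + deficit t) + order t)
    ≡⟨ cong₂ (λ x y → suc (rooted t) * x + rooted s * (y + order t))
             (rootedSum+deficit s) (rootedSum+deficit t) ⟩
  suc (rooted t) * (order s * rooted s) + rooted s * (order t * rooted t + order t)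
    ≡⟨ lem₂ (rooted s) (rooted t) (order s) (order t) ⟩
  (order s + order t) * (rooted s * suc (rooted t)) ∎
  where
  open ≡-Reasoning
  lem : ∀ rs a b rt ds dt nt → rs + (a * rs + b * rt) + (suc a * ds + b * (dt + nt))
        ≡ suc a * (rs + ds) + b * ((rt + dt) + nt)
  lem = solve-∀
  lem₂ : ∀ a b m n → suc b * (m * a) + a * (n * b + n) ≡ (m + n) * (a * suc b)
  lem₂ = solve-∀

rootedSum≤ : ∀ t → rootedSum t ≤ order t * rooted t
rootedSum≤ t = ≤-trans (m≤m+n _ (deficit t)) (≤-reflexive (rootedSum+deficit t))

innerSum≤ : ∀ t → innerSum t ≤ order t * inner t
innerSum≤ ∙       = z≤n
innerSum≤ (s ◁ t) = begin
  innerSum s + (innerSum t + rootedSum t)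
    ≤⟨ +-mono-≤ (innerSum≤ s) (+-mono-≤ (innerSum≤ t) (rootedSum≤ t)) ⟩
  order s * inner s + (order t * inner t + order t * rooted t)
    ≤⟨ +-mono-≤ (*-monoˡ-≤ (inner s) (m≤m+n (order s) (order t)))
        (≤-trans (≤-reflexive (sym (*-distribˡ-+ (order t) (inner t) (rooted t))))
                 (*-monoˡ-≤ (inner t + rooted t) (m≤n+m (order t) (order s)))) ⟩
  (order s + order t) * inner s + (order s + order t) * (inner t + rooted t)
    ≡⟨ *-distribˡ-+ (order s + order t) (inner s) _ ⟨
  (order s + order t) * (inner s + (inner t + rooted t)) ∎
  where open ≤-Reasoning

-- The entropy bound

-- The options for a branch, the empty one included, are distinct vertex sets. In `branch-entropy`
-- this lets the deficit of the empty branch pay for the new option.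
1+rooted≤2^order : ∀ t → suc (rooted t) ≤ 2 ^ order t
1+rooted≤2^order ∙       = ≤-refl
1+rooted≤2^order (s ◁ t) = begin
  suc (rooted s * suc (rooted t)) ≤⟨ +-monoˡ-≤ (rooted s * suc (rooted t)) (s≤s (z≤n {rooted t})) ⟩
  suc (rooted s) * suc (rooted t) ≤⟨ *-mono-≤ (1+rooted≤2^order s) (1+rooted≤2^order t) ⟩
  2 ^ order s * 2 ^ order t ≡⟨ ^-distribˡ-+-* 2 (order s) (order t) ⟨
  2 ^ (order s + order t) ∎
  where open ≤-Reasoning

-- This is (1 + 1/a)^k ≤ 1 + k; each factor adds at most 1 because `suc k ≤ a` in the induction
-- step.
[1+a]^k≤[1+k]a^k : ∀ a k → k ≤ a → suc a ^ k ≤ suc k * a ^ k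
[1+a]^k≤[1+k]a^k a zero    _   = ≤-refl
[1+a]^k≤[1+k]a^k a (suc k) k<a = begin
  suc a * suc a ^ k             ≤⟨ *-monoʳ-≤ (suc a) ([1+a]^k≤[1+k]a^k a k (<⇒≤ k<a)) ⟩
  suc a * (suc k * a ^ k)       ≡⟨ lem a k (a ^ k) ⟩
  suc k * a ^ suc k + suc k * a ^ k ≤⟨ +-monoʳ-≤ (suc k * a ^ suc k) (*-monoˡ-≤ (a ^ k) k<a) ⟩
  suc k * a ^ suc k + a ^ suc k ≡⟨ +-comm (suc k * a ^ suc k) _ ⟩
  suc (suc k) * a ^ suc k ∎
  where
  open ≤-Reasoning
  lem : ∀ a k p → suc a * (suc k * p) ≡ suc k * (a * p) + suc k * p
  lem = solve-∀

^-distribʳ-* : ∀ k m n → (m * n) ^ k ≡ m ^ k * n ^ k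
^-distribʳ-* zero    m n = refl
^-distribʳ-* (suc k) m n = trans (cong (m * n *_) (^-distribʳ-* k m n)) (lem m n (m ^ k) (n ^ k))
  where
  lem : ∀ m n p q → m * n * (p * q) ≡ m * p * (n * q)
  lem = solve-∀

-- The uniform distribution on the subtrees has entropy at most twice the mean deficit.
branch-entropy : ∀ a d n → suc a ≤ 2 ^ n → a ^ a ≤ 4 ^ d → suc a ^ suc a ≤ 4 ^ (d + n)
branch-entropy a d n a<2^n h = begin
  suc a * suc a ^ a          ≤⟨ *-monoʳ-≤ (suc a) ([1+a]^k≤[1+k]a^k a a ≤-refl) ⟩
  suc a * (suc a * a ^ a)    ≡⟨ *-assoc (suc a) (suc a) (a ^ a) ⟨
  suc a * suc a * a ^ a      ≤⟨ *-mono-≤ (*-mono-≤ a<2^n a<2^n) h ⟩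
  2 ^ n * 2 ^ n * 4 ^ d      ≡⟨ cong (_* 4 ^ d) (^-distribʳ-* n 2 2) ⟨
  4 ^ n * 4 ^ d              ≡⟨ *-comm (4 ^ n) (4 ^ d) ⟩
  4 ^ d * 4 ^ n              ≡⟨ ^-distribˡ-+-* 4 d n ⟨
  4 ^ (d + n) ∎
  where open ≤-Reasoning

-- The hypotheses bound log x by (log k) / a and log y by (log l) / b. These are added and the
-- common denominator `a * b` is cleared.
^-product-mean : ∀ {x y k l} a b → x ^ a ≤ k → y ^ b ≤ l → (x * y) ^ (a * b) ≤ k ^ b * l ^ a
^-product-mean {x} {y} {k} {l} a b hx hy = begin
  (x * y) ^ (a * b)           ≡⟨ ^-distribʳ-* (a * b) x y ⟩
  x ^ (a * b) * y ^ (a * b)   ≡⟨ cong₂ _*_ (sym (^-*-assoc x a b))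
                                  (trans (cong (y ^_) (*-comm a b)) (sym (^-*-assoc y b a))) ⟩
  (x ^ a) ^ b * (y ^ b) ^ a   ≤⟨ *-mono-≤ (^-monoˡ-≤ b hx) (^-monoˡ-≤ a hy) ⟩
  k ^ b * l ^ a ∎
  where open ≤-Reasoning

join-power : ∀ c d e a b → (c ^ d) ^ b * (c ^ e) ^ a ≡ c ^ (b * d + a * e)
join-power c d e a b = begin
  (c ^ d) ^ b * (c ^ e) ^ a ≡⟨ cong₂ _*_ (^-*-assoc c d b) (^-*-assoc c e a) ⟩
  c ^ (d * b) * c ^ (e * a) ≡⟨ ^-distribˡ-+-* c (d * b) (e * a) ⟨
  c ^ (d * b + e * a)       ≡⟨ cong₂ (λ x y → c ^ (x + y)) (*-comm d b) (*-comm e a) ⟩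
  c ^ (b * d + a * e) ∎
  where open ≡-Reasoning

-- A subtree through the root of `s ◁ t` is an independent pair of a subtree of `s` and an option
-- for the branch, so entropy and mean deficit are both additive over the two.
rooted-entropy : ∀ t → rooted t ^ rooted t ≤ 4 ^ deficit t
rooted-entropy ∙       = ≤-refl
rooted-entropy (s ◁ t) = begin
  (rooted s * suc (rooted t)) ^ (rooted s * suc (rooted t))
    ≤⟨ ^-product-mean (rooted s) (suc (rooted t)) (rooted-entropy s)
         (branch-entropy (rooted t) (deficit t) (order t) (1+rooted≤2^order t) (rooted-entropy t)) ⟩
  (4 ^ deficit s) ^ suc (rooted t) * (4 ^ (deficit t + order t)) ^ rooted s
    ≡⟨ join-power 4 (deficit s) (deficit t + order t) (rooted s) (suc (rooted t)) ⟩
  4 ^ deficit (s ◁ t) ∎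
  where open ≤-Reasoning

-- Logarithmic lower bound on the mean deficit

-- From three vertices on the mean deficit is at least 1, which is what doubling the order costs in
-- log₂. The two smaller trees have mean deficits 0 and 1/2 and are treated by hand in the gain
-- lemmas.
data Size : RTree → Set where
  one   : Size ∙
  two   : Size (∙ ◁ ∙)
  three : ∀ {t} → 3 ≤ order t → rooted t ≤ deficit t → Size t

measure : ∀ t → Size t
measure ∙       = one
measure (s ◁ t) with measure t
... | two = three (≤-trans (s≤s ≤-refl) (+-monoˡ-≤ 2 (order>0 s)))
                  (m≤n+m (rooted s * 3) _)
... | three 3≤n a≤d = three (≤-trans 3≤n (m≤n+m _ (order s)))
        (≤-trans (*-monoʳ-≤ (rooted s) (≤-trans (+-mono-≤ (order>0 t) a≤d) (≤-reflexive (+-comm (order t) (deficit t)))))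
                 (m≤n+m _ (suc (rooted t) * deficit s)))
... | one with measure s
...   | one = two
...   | two = three ≤-refl ≤-refl
...   | three 3≤n a≤d = three (≤-trans 3≤n (m≤m+n (order s) 1)) (begin
          rooted s * 2                      ≡⟨ lem (rooted s) ⟩
          rooted s + rooted s * 1           ≤⟨ +-monoˡ-≤ (rooted s * 1) (≤-trans a≤d (m≤m+n (deficit s) _)) ⟩
          2 * deficit s + rooted s * 1 ∎)
  where
  open ≤-Reasoning
  lem : ∀ a → a * 2 ≡ a + a * 1
  lem = solve-∀

-- The mean deficit d / a is at least log₂ n − 3, with the logarithm exponentiated away.
LogBound : (n a d : ℕ) → Set
LogBound n a d = n ^ a ≤ 2 ^ d * 8 ^ a

-- This is (1 + 1/n)^k ≤ 1 + 2k/n with denominators cleared. In the induction step the cross term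
-- 2k/n² is at most 1/n.
n[1+n]^k≤n^k[n+2k] : ∀ n k → 2 * k ≤ n → n * suc n ^ k ≤ n ^ k * (n + 2 * k)
n[1+n]^k≤n^k[n+2k] n zero    _ = ≤-reflexive (lem n)
  where
  lem : ∀ n → n * 1 ≡ 1 * (n + 0)
  lem = solve-∀
n[1+n]^k≤n^k[n+2k] n (suc k) 2k+2≤n = begin
  n * (suc n * suc n ^ k)               ≡⟨ lem₁ n (suc n ^ k) ⟩
  suc n * (n * suc n ^ k)               ≤⟨ *-monoʳ-≤ (suc n) (n[1+n]^k≤n^k[n+2k] n k 2k≤n) ⟩
  suc n * (n ^ k * (n + 2 * k))         ≡⟨ lem₂ n k (n ^ k) ⟩
  n ^ k * (n * (n + 2 * k) + n + 2 * k) ≤⟨ *-monoʳ-≤ (n ^ k) (+-monoʳ-≤ (n * (n + 2 * k) + n) 2k≤n) ⟩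
  n ^ k * (n * (n + 2 * k) + n + n)     ≡⟨ lem₃ n k (n ^ k) ⟩
  n ^ suc k * (n + 2 * suc k) ∎
  where
  open ≤-Reasoning
  2k≤n : 2 * k ≤ n
  2k≤n = ≤-trans (*-monoʳ-≤ 2 (n≤1+n k)) 2k+2≤n
  lem₁ : ∀ n p → n * (suc n * p) ≡ suc n * (n * p)
  lem₁ = solve-∀
  lem₂ : ∀ n k p → suc n * (p * (n + 2 * k)) ≡ p * (n * (n + 2 * k) + n + 2 * k)
  lem₂ = solve-∀
  lem₃ : ∀ n k p → p * (n * (n + 2 * k) + n + n) ≡ n * p * (n + 2 * suc k)
  lem₃ = solve-∀

[1+n]^k≤2n^k : ∀ n .{{_ : NonZero n}} k → 2 * k ≤ n → suc n ^ k ≤ 2 * n ^ k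
[1+n]^k≤2n^k n k 2k≤n = *-cancelˡ-≤ n (begin
  n * suc n ^ k         ≤⟨ n[1+n]^k≤n^k[n+2k] n k 2k≤n ⟩
  n ^ k * (n + 2 * k)   ≤⟨ *-monoʳ-≤ (n ^ k) (+-monoʳ-≤ n 2k≤n) ⟩
  n ^ k * (n + n)       ≡⟨ lem n (n ^ k) ⟩
  n * (2 * n ^ k) ∎)
  where
  open ≤-Reasoning
  lem : ∀ n p → p * (n + n) ≡ n * (2 * p)
  lem = solve-∀

-- The k-th power of `[1+n]^k≤2n^k` is the case of exponent k². A smaller exponent `a` is padded
-- with `r` further factors, which are then cancelled.
[1+n]^a≤2^k*n^a : ∀ n .{{_ : NonZero n}} k a → 2 * k ≤ n → a ≤ k * k → suc n ^ a ≤ 2 ^ k * n ^ a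
[1+n]^a≤2^k*n^a n k a 2k≤n a≤k² = *-cancelʳ-≤ _ _ (n ^ r) {{m^n≢0 n r}} (begin
  suc n ^ a * n ^ r       ≤⟨ *-monoʳ-≤ (suc n ^ a) (^-monoˡ-≤ r (n≤1+n n)) ⟩
  suc n ^ a * suc n ^ r   ≡⟨ ^-distribˡ-+-* (suc n) a r ⟨
  suc n ^ (a + r)         ≡⟨ cong (suc n ^_) a+r ⟩
  suc n ^ (k * k)         ≡⟨ ^-*-assoc (suc n) k k ⟨
  (suc n ^ k) ^ k         ≤⟨ ^-monoˡ-≤ k ([1+n]^k≤2n^k n k 2k≤n) ⟩
  (2 * n ^ k) ^ k         ≡⟨ ^-distribʳ-* k 2 (n ^ k) ⟩
  2 ^ k * (n ^ k) ^ k     ≡⟨ cong (2 ^ k *_) (^-*-assoc n k k) ⟩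
  2 ^ k * n ^ (k * k)     ≡⟨ cong (λ m → 2 ^ k * n ^ m) a+r ⟨
  2 ^ k * n ^ (a + r)     ≡⟨ cong (2 ^ k *_) (^-distribˡ-+-* n a r) ⟩
  2 ^ k * (n ^ a * n ^ r) ≡⟨ *-assoc (2 ^ k) (n ^ a) (n ^ r) ⟨
  2 ^ k * n ^ a * n ^ r ∎)
  where
  open ≤-Reasoning
  r : ℕ
  r = k * k ∸ a
  a+r : a + r ≡ k * k
  a+r = m+[n∸m]≡n a≤k²

n<2^n : ∀ n → n < 2 ^ n
n<2^n zero    = ≤-refl
n<2^n (suc n) = begin-strict
  suc n         ≤⟨ n<2^n n ⟩
  2 ^ n         <⟨ m<m+n (2 ^ n) (m^n>0 2 n) ⟩
  2 ^ n + 2 ^ n ≡⟨ cong (2 ^ n +_) (+-identityʳ (2 ^ n)) ⟨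
  2 ^ suc n ∎
  where open ≤-Reasoning

m*m≤n*n⇒m≤n : ∀ m n → m * m ≤ n * n → m ≤ n
m*m≤n*n⇒m≤n m n h = ≮⇒≥ λ n<m → <⇒≱ (*-mono-< n<m n<m) h

2⌊n/2⌋≤n : ∀ n → 2 * ⌊ n /2⌋ ≤ n
2⌊n/2⌋≤n n = begin
  2 * ⌊ n /2⌋           ≡⟨ cong (⌊ n /2⌋ +_) (+-identityʳ _) ⟩
  ⌊ n /2⌋ + ⌊ n /2⌋     ≤⟨ +-monoʳ-≤ ⌊ n /2⌋ (⌊n/2⌋≤⌈n/2⌉ n) ⟩
  ⌊ n /2⌋ + ⌈ n /2⌉     ≡⟨ ⌊n/2⌋+⌈n/2⌉≡n n ⟩
  n ∎
  where open ≤-Reasoning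

1+n≤2[1+⌊n/2⌋] : ∀ n → suc n ≤ 2 * suc ⌊ n /2⌋
1+n≤2[1+⌊n/2⌋] zero          = s≤s z≤n
1+n≤2[1+⌊n/2⌋] (suc zero)    = s≤s (s≤s z≤n)
1+n≤2[1+⌊n/2⌋] (suc (suc n)) = ≤-trans (s≤s (s≤s (1+n≤2[1+⌊n/2⌋] n))) (≤-reflexive (lem ⌊ n /2⌋))
  where
  lem : ∀ k → 2 + 2 * suc k ≡ 2 * suc (suc k)
  lem = solve-∀

-- With at most about n² subtrees, lengthening the branch by one edge costs enough deficit;
-- with more, the entropy bound takes over.
branch-logBound : ∀ n a d .{{_ : NonZero n}} → suc a ^ suc a ≤ 4 ^ (d + n) →
                  LogBound n a d → LogBound (suc n) (suc a) (d + n)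
branch-logBound n a d ent h with ⌊ n /2⌋ | 2⌊n/2⌋≤n n | 1+n≤2[1+⌊n/2⌋] n
... | zero | _ | n<2 = begin
  suc n ^ suc a               ≤⟨ ^-monoˡ-≤ (suc a) (≤-trans n<2 (s≤s (s≤s z≤n))) ⟩
  8 ^ suc a                   ≤⟨ m≤n*m (8 ^ suc a) (2 ^ (d + n)) {{m^n≢0 2 (d + n)}} ⟩
  2 ^ (d + n) * 8 ^ suc a ∎
  where open ≤-Reasoning
... | k@(suc _) | 2k≤n | n<2k+2 with a ≤? k * k
-- The extra deficit `n` is at least `2 * k`: one `k` pays for replacing `n ^ a` by `suc n ^ a`, the
-- other for the new factor `suc n`. The leftover factor 2 goes into the additional 8.
...   | yes a≤k² = begin
  suc n * suc n ^ a                           ≤⟨ *-mono-≤ 1+n≤2*2^k ([1+n]^a≤2^k*n^a n k a 2k≤n a≤k²) ⟩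
  2 * 2 ^ k * (2 ^ k * n ^ a)                 ≡⟨ lem₁ (2 ^ k) (n ^ a) ⟩
  2 * (2 ^ k * 2 ^ k) * n ^ a                 ≤⟨ *-mono-≤ (*-mono-≤ {2} {8} (s≤s (s≤s z≤n)) 2^k*2^k≤2^n) h ⟩
  8 * 2 ^ n * (2 ^ d * 8 ^ a)                 ≡⟨ lem₂ (2 ^ n) (2 ^ d) (8 ^ a) ⟩
  2 ^ d * 2 ^ n * (8 * 8 ^ a)                 ≡⟨ cong (_* 8 ^ suc a) (^-distribˡ-+-* 2 d n) ⟨
  2 ^ (d + n) * 8 ^ suc a ∎
  where
  open ≤-Reasoning
  1+n≤2*2^k : suc n ≤ 2 * 2 ^ k
  1+n≤2*2^k = ≤-trans n<2k+2 (*-monoʳ-≤ 2 (n<2^n k))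
  2^k*2^k≤2^n : 2 ^ k * 2 ^ k ≤ 2 ^ n
  2^k*2^k≤2^n = ≤-trans (≤-reflexive (trans (sym (^-distribˡ-+-* 2 k k)) (cong (λ j → 2 ^ (k + j)) (sym (+-identityʳ k)))))
                        (^-monoʳ-≤ 2 2k≤n)
  lem₁ : ∀ p q → 2 * p * (p * q) ≡ 2 * (p * p) * q
  lem₁ = solve-∀
  lem₂ : ∀ p q r → 8 * p * (q * r) ≡ q * p * (8 * r)
  lem₂ = solve-∀
-- Here k² < a, so the square root of the entropy bound gives `k ^ suc a ≤ 2 ^ (d + n)`. The factor
-- 8 covers the loss from `suc n` to `k`.
...   | no a≰k² = begin
  suc n ^ suc a               ≤⟨ ^-monoˡ-≤ (suc a) 1+n≤k*8 ⟩
  (k * 8) ^ suc a             ≡⟨ ^-distribʳ-* (suc a) k 8 ⟩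
  k ^ suc a * 8 ^ suc a       ≤⟨ *-monoˡ-≤ (8 ^ suc a) (m*m≤n*n⇒m≤n (k ^ suc a) (2 ^ (d + n)) sq) ⟩
  2 ^ (d + n) * 8 ^ suc a ∎
  where
  open ≤-Reasoning
  1+n≤k*8 : suc n ≤ k * 8
  1+n≤k*8 = begin
    suc n         ≤⟨ n<2k+2 ⟩
    2 * (1 + k)   ≤⟨ *-monoʳ-≤ 2 (+-monoˡ-≤ k {1} {3 * k} (s≤s z≤n)) ⟩
    2 * (3 * k + k) ≡⟨ lem k ⟩
    k * 8 ∎
    where
    lem : ∀ k → 2 * (3 * k + k) ≡ k * 8
    lem = solve-∀
  sq : k ^ suc a * k ^ suc a ≤ 2 ^ (d + n) * 2 ^ (d + n)
  sq = begin
    k ^ suc a * k ^ suc a     ≡⟨ ^-distribʳ-* (suc a) k k ⟨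
    (k * k) ^ suc a           ≤⟨ ^-monoˡ-≤ (suc a) (≤-trans (<⇒≤ (≰⇒> a≰k²)) (n≤1+n a)) ⟩
    suc a ^ suc a             ≤⟨ ent ⟩
    4 ^ (d + n)               ≡⟨ ^-distribʳ-* (d + n) 2 2 ⟩
    2 ^ (d + n) * 2 ^ (d + n) ∎

power-gain : ∀ {x z k l} a b → x ^ a ≤ k → z ^ b ≤ x ^ b * l → z ^ (a * b) ≤ k ^ b * l ^ a
power-gain {x} {z} {k} {l} a b hx hz = begin
  z ^ (a * b)             ≡⟨ cong (z ^_) (*-comm a b) ⟩
  z ^ (b * a)             ≡⟨ ^-*-assoc z b a ⟨
  (z ^ b) ^ a             ≤⟨ ^-monoˡ-≤ a hz ⟩
  (x ^ b * l) ^ a         ≡⟨ ^-distribʳ-* a (x ^ b) l ⟩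
  (x ^ b) ^ a * l ^ a     ≡⟨ cong (_* l ^ a) (trans (^-*-assoc x b a) (trans (cong (x ^_) (*-comm b a)) (sym (^-*-assoc x a b)))) ⟩
  (x ^ a) ^ b * l ^ a     ≤⟨ *-monoˡ-≤ (l ^ a) (^-monoˡ-≤ b hx) ⟩
  k ^ b * l ^ a ∎
  where open ≤-Reasoning

-- Only one part needs a logarithmic bound. The other, with `b` options of total deficit `e`, has to
-- pay just for the growth from log₂ x to log₂ z with its mean e / b.
logBound-gain : ∀ {x z} a b d e → LogBound x a d → z ^ b ≤ x ^ b * 2 ^ e → LogBound z (a * b) (b * d + a * e)
logBound-gain {x} {z} a b d e hx hz = begin
  z ^ (a * b)                               ≤⟨ power-gain {x} {z} a b hx hz ⟩
  (2 ^ d * 8 ^ a) ^ b * (2 ^ e) ^ a         ≡⟨ cong (_* (2 ^ e) ^ a) (^-distribʳ-* b (2 ^ d) (8 ^ a)) ⟩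
  (2 ^ d) ^ b * (8 ^ a) ^ b * (2 ^ e) ^ a   ≡⟨ lem ((2 ^ d) ^ b) ((8 ^ a) ^ b) ((2 ^ e) ^ a) ⟩
  (2 ^ d) ^ b * (2 ^ e) ^ a * (8 ^ a) ^ b   ≡⟨ cong₂ _*_ (join-power 2 d e a b) (^-*-assoc 8 a b) ⟩
  2 ^ (b * d + a * e) * 8 ^ (a * b) ∎
  where
  open ≤-Reasoning
  lem : ∀ p q r → p * q * r ≡ p * r * q
  lem = solve-∀

z≤2x⇒z^b≤x^b*2^e : ∀ {x z b e} → z ≤ x + x → b ≤ e → z ^ b ≤ x ^ b * 2 ^ e
z≤2x⇒z^b≤x^b*2^e {x} {z} {b} {e} z≤2x b≤e = begin
  z ^ b           ≤⟨ ^-monoˡ-≤ b z≤2x ⟩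
  (x + x) ^ b     ≡⟨ cong (_^ b) (lem x) ⟩
  (x * 2) ^ b     ≡⟨ ^-distribʳ-* b x 2 ⟩
  x ^ b * 2 ^ b   ≤⟨ *-monoʳ-≤ (x ^ b) (^-monoʳ-≤ 2 b≤e) ⟩
  x ^ b * 2 ^ e ∎
  where
  open ≤-Reasoning
  lem : ∀ x → x + x ≡ x * 2
  lem = solve-∀

-- A mean deficit of 1/2 pays for one more vertex: log₂ (1 + 1/x) ≤ 1/2, and 3 is the least such
-- `x`.
[1+x]²≤2x² : ∀ {x} → 3 ≤ x → suc x ^ 2 ≤ x ^ 2 * 2 ^ 1
[1+x]²≤2x² {x} 3≤x = begin
  suc x ^ 2             ≡⟨ lem₁ x ⟩
  x * x + (x + x + 1)   ≤⟨ +-monoʳ-≤ (x * x) (+-monoʳ-≤ (x + x) (≤-trans (s≤s z≤n) 3≤x)) ⟩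
  x * x + (x + x + x)   ≡⟨ lem₂ x ⟩
  x * x + 3 * x         ≤⟨ +-monoʳ-≤ (x * x) (*-monoˡ-≤ x 3≤x) ⟩
  x * x + x * x         ≡⟨ lem₃ x ⟩
  x ^ 2 * 2 ^ 1 ∎
  where
  open ≤-Reasoning
  lem₁ : ∀ x → suc x * (suc x * 1) ≡ x * x + (x + x + 1)
  lem₁ = solve-∀
  lem₂ : ∀ x → x * x + (x + x + x) ≡ x * x + 3 * x
  lem₂ = solve-∀
  lem₃ : ∀ x → x * x + x * x ≡ x * (x * 1) * 2
  lem₃ = solve-∀

large : ∀ {m n} → 8 < m + n → n ≤ m → 4 ≤ m
large {m} {n} 8<m+n n≤m = ≮⇒≥ λ m<4 → <⇒≱ 8<m+n (≤-trans (+-mono-≤ (<⇒≤ m<4) (≤-trans n≤m (<⇒≤ m<4))) ≤-refl)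

-- Here `suc x` is the order of a branch together with the root above it. That root is shared with
-- `s`, so the union has `x + order s` vertices.
rooted-gain : ∀ s x → 4 ≤ x → order s ≤ suc x → (x + order s) ^ rooted s ≤ suc x ^ rooted s * 2 ^ deficit s
rooted-gain s x 4≤x n≤x with measure s
... | one       = ≤-reflexive (trans (cong (_^ 1) (+-comm x 1)) (sym (*-identityʳ _)))
... | two       = ≤-trans (≤-reflexive (cong (_^ 2) (+-comm x 2))) ([1+x]²≤2x² (≤-trans (s≤s (s≤s (s≤s z≤n))) (≤-trans 4≤x (n≤1+n x))))
... | three _ a≤d = z≤2x⇒z^b≤x^b*2^e (+-mono-≤ (n≤1+n x) n≤x) a≤d

-- Counting the empty option, a branch of one vertex has mean deficit 1/2, and one of two vertices
-- already has mean deficit 1.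
branch-gain : ∀ t x → 4 ≤ x → order t ≤ x → (x + order t) ^ suc (rooted t) ≤ x ^ suc (rooted t) * 2 ^ (deficit t + order t)
branch-gain t x 4≤x n≤x with measure t
... | one = ≤-trans (≤-reflexive (cong (_^ 2) (+-comm x 1))) ([1+x]²≤2x² (≤-trans (s≤s (s≤s (s≤s z≤n))) 4≤x))
... | two = z≤2x⇒z^b≤x^b*2^e {x} {b = 3} {3} (+-monoʳ-≤ x n≤x) ≤-refl
... | three 3≤n a≤d = z≤2x⇒z^b≤x^b*2^e {x} (+-monoʳ-≤ x n≤x)
        (≤-trans (+-mono-≤ (≤-trans (s≤s z≤n) 3≤n) a≤d) (≤-reflexive (+-comm (order t) _)))

-- The larger of the two parts supplies the bound by induction. The smaller one at most doubles the
-- order, and its own mean deficit pays for that. If the branch is the larger part, it is first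
-- lengthened by the edge to the root, through `branch-logBound`.
rooted-logBound : ∀ t → LogBound (order t) (rooted t) (deficit t)
rooted-logBound ∙       = s≤s z≤n
rooted-logBound (s ◁ t) with order s + order t ≤? 8
-- The factor `8 ^ a` alone settles orders up to eight. Beyond that the larger part has at least the
-- four vertices that the gain lemmas ask for.
... | yes n≤8 = ≤-trans (^-monoˡ-≤ (rooted (s ◁ t)) n≤8) (m≤n*m _ _ {{m^n≢0 2 (deficit (s ◁ t))}})
... | no n≰8 with order t ≤? order s
...   | yes t≤s = logBound-gain {order s} (rooted s) (suc (rooted t)) (deficit s) _ (rooted-logBound s)
                    (branch-gain t (order s) (large (≰⇒> n≰8) t≤s) t≤s)
...   | no t≰s = subst₂ (LogBound (order s + order t)) (*-comm (suc (rooted t)) (rooted s))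
                   (+-comm (rooted s * (deficit t + order t)) _)
                   (logBound-gain {suc (order t)} (suc (rooted t)) (rooted s) (deficit t + order t) (deficit s)
                     (branch-logBound (order t) (rooted t) (deficit t) {{>-nonZero (order>0 t)}}
                       (branch-entropy (rooted t) (deficit t) (order t) (1+rooted≤2^order t) (rooted-entropy t))
                       (rooted-logBound t))
                     (subst (λ z → z ^ rooted s ≤ suc (order t) ^ rooted s * 2 ^ deficit s) (+-comm (order t) (order s))
                       (rooted-gain s (order t)
                         (large (subst (8 <_) (+-comm (order s) (order t)) (≰⇒> n≰8)) (<⇒≤ s<t))
                         (≤-trans (<⇒≤ s<t) (n≤1+n _)))))
  where
  s<t : order s < order t
  s<t = ≰⇒> t≰s

-- Moving the root

-- Reordering the children of a root changes the term but none of these five numbers, and `joinᵖ`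
-- computes the profile of `s ◁ t` from those of its parts. Equality of profiles is thus a
-- congruence that stands in for isomorphism of rooted trees.
record Profile : Set where
  constructor ⟨_,_,_,_,_⟩
  field
    ord root rootSum inn innSum : ℕ

profile : RTree → Profile
profile t = ⟨ order t , rooted t , rootedSum t , inner t , innerSum t ⟩

joinᵖ : Profile → Profile → Profile
joinᵖ ⟨ n , a , r , m , z ⟩ ⟨ n′ , a′ , r′ , m′ , z′ ⟩ =
  ⟨ n + n′ , a * suc a′ , r + (a′ * r + a * r′) , m + (m′ + a′) , z + (z′ + r′) ⟩

totalᵖ : Profile → ℕ × ℕ
totalᵖ ⟨ n , a , r , m , z ⟩ = a + m , r + z

total : RTree → ℕ × ℕ
total t = totalᵖ (profile t)

cong-⟨⟩ : ∀ {n n′ a a′ r r′ m m′ z z′} → n ≡ n′ → a ≡ a′ → r ≡ r′ → m ≡ m′ → z ≡ z′ →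
          ⟨ n , a , r , m , z ⟩ ≡ ⟨ n′ , a′ , r′ , m′ , z′ ⟩
cong-⟨⟩ refl refl refl refl refl = refl

infix 4 _≈_
_≈_ : RTree → RTree → Set
s ≈ t = profile s ≡ profile t

◁-swap : ∀ s t u → s ◁ t ◁ u ≈ s ◁ u ◁ t
◁-swap s t u = cong-⟨⟩ (lem₁ (order s) (order t) (order u))
  (lem₂ (rooted s) (rooted t) (rooted u))
  (lem₃ (rootedSum s) (rootedSum t) (rootedSum u) (rooted s) (rooted t) (rooted u))
  (lem₄ (inner s) (inner t) (inner u) (rooted t) (rooted u))
  (lem₄ (innerSum s) (innerSum t) (innerSum u) (rootedSum t) (rootedSum u))
  where
  lem₁ : ∀ a b c → a + b + c ≡ a + c + b
  lem₁ = solve-∀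
  lem₂ : ∀ a b c → a * suc b * suc c ≡ a * suc c * suc b
  lem₂ = solve-∀
  lem₃ : ∀ x y z a b c → x + (b * x + a * y) + (c * (x + (b * x + a * y)) + a * suc b * z)
                       ≡ x + (c * x + a * z) + (b * (x + (c * x + a * z)) + a * suc c * y)
  lem₃ = solve-∀
  lem₄ : ∀ a b c d e → a + (b + d) + (c + e) ≡ a + (c + e) + (b + d)
  lem₄ = solve-∀

-- The two terms are one tree with the root moved across an edge. The split into rooted and inner
-- subtrees changes; their totals do not.
◁-comm-total : ∀ s t → total (s ◁ t) ≡ total (t ◁ s)
◁-comm-total s t = cong₂ _,_
  (lem₁ (rooted s) (rooted t) (inner s) (inner t))
  (lem₂ (rootedSum s) (rootedSum t) (innerSum s) (innerSum t) (rooted s) (rooted t))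
  where
  lem₁ : ∀ a b x y → a * suc b + (x + (y + b)) ≡ b * suc a + (y + (x + a))
  lem₁ = solve-∀
  lem₂ : ∀ p q x y a b → p + (b * p + a * q) + (x + (y + q)) ≡ q + (a * q + b * p) + (y + (x + p))
  lem₂ = solve-∀

infixl 7 _·_

-- Identification of the two roots.
_·_ : RTree → RTree → RTree
s · ∙       = s
s · (t ◁ u) = (s ◁ u) · t

·-congˡ : ∀ {s s′} t → s ≈ s′ → s · t ≈ s′ · t
·-congˡ ∙       eq = eq
·-congˡ (t ◁ u) eq = ·-congˡ t (cong (λ p → joinᵖ p (profile u)) eq)

◁-· : ∀ s u t → (s ◁ u) · t ≈ s · t ◁ u
◁-· s u ∙       = refl
◁-· s u (t ◁ v) = trans (·-congˡ t (◁-swap s u v)) (◁-· (s ◁ v) u t)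

∙-· : ∀ t → ∙ · t ≈ t
∙-· ∙       = refl
∙-· (t ◁ u) = trans (◁-· ∙ u t) (cong (λ p → joinᵖ p (profile u)) (∙-· t))

order-· : ∀ s t → suc (order (s · t)) ≡ order s + order t
order-· s ∙       = sym (+-comm (order s) 1)
order-· s (t ◁ u) = trans (order-· (s ◁ u) t) (lem (order s) (order t) (order u))
  where
  lem : ∀ a b c → a + c + b ≡ a + (b + c)
  lem = solve-∀

rooted-· : ∀ s t → rooted (s · t) ≡ rooted s * rooted t
rooted-· s ∙       = sym (*-identityʳ (rooted s))
rooted-· s (t ◁ u) = trans (rooted-· (s ◁ u) t) (lem (rooted s) (rooted t) (rooted u))
  where
  lem : ∀ a b c → a * suc c * b ≡ a * (b * suc c)
  lem = solve-∀

inner-· : ∀ s t → inner (s · t) ≡ inner s + inner t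
inner-· s ∙       = sym (+-identityʳ (inner s))
inner-· s (t ◁ u) = trans (inner-· (s ◁ u) t) (lem (inner s) (inner t) (inner u + rooted u))
  where
  lem : ∀ a b c → a + c + b ≡ a + (b + c)
  lem = solve-∀

innerSum-· : ∀ s t → innerSum (s · t) ≡ innerSum s + innerSum t
innerSum-· s ∙       = sym (+-identityʳ (innerSum s))
innerSum-· s (t ◁ u) = trans (innerSum-· (s ◁ u) t) (lem (innerSum s) (innerSum t) (innerSum u + rootedSum u))
  where
  lem : ∀ a b c → a + c + b ≡ a + (b + c)
  lem = solve-∀

-- After division by `rooted s * rooted t` this says that mean deficits add when roots are
-- identified.
deficit-· : ∀ s t → deficit (s · t) ≡ rooted t * deficit s + rooted s * deficit t
deficit-· s ∙       = lem (deficit s) (rooted s)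
  where
  lem : ∀ d a → d ≡ 1 * d + a * 0
  lem = solve-∀
deficit-· s (t ◁ u) = trans (deficit-· (s ◁ u) t)
  (lem (rooted s) (rooted t) (rooted u) (deficit s) (deficit t) (deficit u) (order u))
  where
  lem : ∀ a b c x y z n → b * (suc c * x + a * (z + n)) + a * suc c * y
                        ≡ b * suc c * x + a * (suc c * y + b * (z + n))
  lem = solve-∀

-- Splitting a tree at a balanced vertex

-- The two parts share the split vertex, whence the `suc`. As that vertex need not be the root of
-- `t`, only the totals over all subtrees are compared.
record Split (t : RTree) : Set where
  constructor split
  field
    left right   : RTree
    order-split  : suc (order t) ≡ order left + order right
    total-split  : total t ≡ total (left · right)
    left-large   : order t ≤ 4 * order left
    right-large  : order t ≤ 4 * order right

remainder-large : ∀ n x y → suc n ≡ x + y → 4 * x ≤ 3 * n + 4 → n ≤ 4 * y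
remainder-large n x y eq h = +-cancelˡ-≤ (3 * n + 4) n (4 * y) (begin
  3 * n + 4 + n     ≡⟨ lem n ⟩
  4 * suc n         ≡⟨ cong (4 *_) eq ⟩
  4 * (x + y)       ≡⟨ *-distribˡ-+ 4 x y ⟩
  4 * x + 4 * y     ≤⟨ +-monoˡ-≤ (4 * y) h ⟩
  3 * n + 4 + 4 * y ∎)
  where
  open ≤-Reasoning
  lem : ∀ n → 3 * n + 4 + n ≡ 4 * suc n
  lem = solve-∀

-- Up to its root, `w` is `p` and `t` glued at the current vertex: `p` holds what has been set
-- aside, `t` what is still to be examined. While `p` has less than a quarter of the vertices, the
-- outermost branch `b` of `t` decides: a small one is added to `p`, a middling one is split off,
-- and one above three quarters is entered.
split-at : ∀ w p t → suc (order w) ≡ order p + order t → total w ≡ total (p · t) →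
           4 * order p ≤ 3 * order w + 4 → Split w
split-at w p t eqn eqt small with order w ≤? 4 * order p
... | yes large = split p t eqn eqt large (remainder-large (order w) (order p) (order t) eqn small)
split-at w p ∙ eqn eqt small | no p-small =
  contradiction (≤-trans (≤-reflexive (suc-injective (trans eqn (+-comm (order p) 1)))) (m≤n*m (order p) 4)) p-small
split-at w p (s ◁ b) eqn eqt small | no p-small with order w ≤? 4 * order b
... | no b-small = split-at w (p ◁ b) s (trans eqn (lem (order p) (order s) (order b))) eqt (begin
    4 * (order p + order b)         ≡⟨ *-distribˡ-+ 4 (order p) (order b) ⟩
    4 * order p + 4 * order b       ≤⟨ +-mono-≤ (<⇒≤ (≰⇒> p-small)) (<⇒≤ (≰⇒> b-small)) ⟩
    order w + order w               ≤⟨ m≤m+n _ (order w + 4) ⟩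
    order w + order w + (order w + 4) ≡⟨ lem₂ (order w) ⟩
    3 * order w + 4 ∎)
  where
  open ≤-Reasoning
  lem : ∀ a b c → a + (b + c) ≡ a + c + b
  lem = solve-∀
  lem₂ : ∀ n → n + n + (n + 4) ≡ 3 * n + 4
  lem₂ = solve-∀
... | yes b-large with 4 * order b ≤? 3 * order w
...   | yes b-small = split (∙ ◁ b) (p · s) eqn′ (trans eqt (cong totalᵖ eqp)) (≤-trans b-large (*-monoʳ-≤ 4 (n≤1+n (order b))))
                        (remainder-large (order w) (suc (order b)) (order (p · s)) eqn′
                          (≤-trans (≤-reflexive (*-suc 4 (order b))) (≤-trans (≤-reflexive (+-comm 4 _)) (+-monoˡ-≤ 4 b-small))))
  where
  eqn′ : suc (order w) ≡ suc (order b) + order (p · s)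
  eqn′ = trans eqn (trans (sym (+-assoc (order p) (order s) (order b)))
           (trans (cong (_+ order b) (sym (order-· p s))) (cong suc (+-comm (order (p · s)) (order b)))))
  eqp : (p ◁ b) · s ≈ (∙ ◁ b) · (p · s)
  eqp = trans (◁-· p b s) (trans (cong (λ q → joinᵖ q (profile b)) (sym (∙-· (p · s)))) (sym (◁-· ∙ b (p · s))))
-- The current vertex moves to the root of `b`; everything outside `b` becomes a single branch
-- there, of at most a quarter of the vertices.
...   | no b-large′ = split-at w (∙ ◁ (p · s)) b eqn′ (trans eqt eqt′) (begin
    4 * suc (order (p · s))           ≡⟨ *-suc 4 (order (p · s)) ⟩
    4 + 4 * order (p · s)             ≤⟨ +-monoʳ-≤ 4 ps-small ⟩
    4 + order w                       ≤⟨ +-monoʳ-≤ 4 (m≤m+n (order w) (order w + (order w + 0))) ⟩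
    4 + 3 * order w                   ≡⟨ +-comm 4 (3 * order w) ⟩
    3 * order w + 4 ∎)
  where
  open ≤-Reasoning
  eqn₀ : order w ≡ order b + order (p · s)
  eqn₀ = suc-injective (trans eqn (trans (sym (+-assoc (order p) (order s) (order b)))
           (trans (cong (_+ order b) (sym (order-· p s))) (cong suc (+-comm (order (p · s)) (order b))))))
  eqn′ : suc (order w) ≡ suc (order (p · s)) + order b
  eqn′ = cong suc (trans eqn₀ (+-comm (order b) _))
  ps-small : 4 * order (p · s) ≤ order w
  ps-small = +-cancelˡ-≤ (3 * order w) _ _ (begin
    3 * order w + 4 * order (p · s)     ≤⟨ +-monoˡ-≤ _ (<⇒≤ (≰⇒> b-large′)) ⟩
    4 * order b + 4 * order (p · s)     ≡⟨ *-distribˡ-+ 4 (order b) _ ⟨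
    4 * (order b + order (p · s))       ≡⟨ cong (4 *_) eqn₀ ⟨
    4 * order w                         ≡⟨ lem (order w) ⟩
    3 * order w + order w ∎)
    where
    lem : ∀ n → 4 * n ≡ 3 * n + n
    lem = solve-∀
  eqt′ : total ((p ◁ b) · s) ≡ total ((∙ ◁ (p · s)) · b)
  eqt′ = trans (cong totalᵖ (◁-· p b s)) (trans (◁-comm-total (p · s) b)
           (cong totalᵖ (sym (trans (◁-· ∙ (p · s) b) (cong (λ q → joinᵖ q (profile (p · s))) (∙-· b))))))

balanced-split : ∀ t → Split t
balanced-split t = split-at t ∙ t refl (cong totalᵖ (sym (∙-· t))) (m≤n+m 4 (3 * order t))

-- Upper bound on the mean of a rooted tree

2^m≤2^n⇒m≤n : ∀ m n → 2 ^ m ≤ 2 ^ n → m ≤ n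
2^m≤2^n⇒m≤n m n h = ≮⇒≥ λ n<m → <⇒≱ (^-monoʳ-< 2 ≤-refl n<m) h

-- The 5 is log₂ 4 for having only a quarter of the vertices plus log₂ 8 from `LogBound`.
logBound⇒deficit : ∀ k t → 2 ^ k ≤ 4 * order t → k * rooted t ≤ deficit t + 5 * rooted t
logBound⇒deficit k t h = 2^m≤2^n⇒m≤n _ _ (begin
  2 ^ (k * rooted t)                            ≡⟨ ^-*-assoc 2 k (rooted t) ⟨
  (2 ^ k) ^ rooted t                            ≤⟨ ^-monoˡ-≤ (rooted t) h ⟩
  (4 * order t) ^ rooted t                      ≡⟨ ^-distribʳ-* (rooted t) 4 (order t) ⟩
  4 ^ rooted t * order t ^ rooted t             ≤⟨ *-monoʳ-≤ (4 ^ rooted t) (rooted-logBound t) ⟩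
  4 ^ rooted t * (2 ^ deficit t * 8 ^ rooted t) ≡⟨ lem (4 ^ rooted t) (2 ^ deficit t) (8 ^ rooted t) ⟩
  2 ^ deficit t * (4 ^ rooted t * 8 ^ rooted t) ≡⟨ cong (2 ^ deficit t *_) (^-distribʳ-* (rooted t) 4 8) ⟨
  2 ^ deficit t * 32 ^ rooted t                 ≡⟨ cong (2 ^ deficit t *_) (^-*-assoc 2 5 (rooted t)) ⟩
  2 ^ deficit t * 2 ^ (5 * rooted t)            ≡⟨ ^-distribˡ-+-* 2 (deficit t) (5 * rooted t) ⟨
  2 ^ (deficit t + 5 * rooted t) ∎)
  where
  open ≤-Reasoning
  lem : ∀ a b c → a * (b * c) ≡ b * (a * c)
  lem = solve-∀

8k≤2^k+24 : ∀ k → 8 * k ≤ 2 ^ k + 24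
8k≤2^k+24 0 = z≤n
8k≤2^k+24 1 = m≤m+n 8 18
8k≤2^k+24 2 = m≤m+n 16 12
8k≤2^k+24 3 = m≤m+n 24 8
8k≤2^k+24 (suc k@(suc (suc (suc j)))) = begin
  8 * suc k                 ≡⟨ *-suc 8 k ⟩
  8 + 8 * k                 ≤⟨ +-mono-≤ (^-monoʳ-≤ 2 (m≤m+n 3 j)) (8k≤2^k+24 k) ⟩
  2 ^ k + (2 ^ k + 24)      ≡⟨ lem (2 ^ k) ⟩
  2 ^ suc k + 24 ∎
  where
  open ≤-Reasoning
  lem : ∀ p → p + (p + 24) ≡ 2 * p + 24
  lem = solve-∀

-- A subtree confined to the part of order `x` misses the rest of the other part, and a quarter of
-- `2 ^ k` is at least 2k - 6 by `8k≤2^k+24`.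
part-small : ∀ k n x y → 2 ^ k ≤ n → suc n ≡ x + y → n ≤ 4 * y → x + 2 * k ≤ n + 10
part-small k n x y 2^k≤n eq n≤4y = *-cancelˡ-≤ 4 (+-cancelʳ-≤ (4 * y) _ _ (begin
  4 * (x + 2 * k) + 4 * y       ≡⟨ lem₁ x y k ⟩
  4 * (x + y) + 8 * k           ≡⟨ cong (λ m → 4 * m + 8 * k) eq ⟨
  4 * suc n + 8 * k             ≤⟨ +-monoʳ-≤ (4 * suc n) (≤-trans (8k≤2^k+24 k) (+-monoˡ-≤ 24 (≤-trans 2^k≤n n≤4y))) ⟩
  -- The 12 weakens the constant from 7 to the 10 = 2 · 5 of `rooted-bound`, so that both kinds of
  -- subtrees obey the same inequality.
  4 * suc n + (4 * y + 24)      ≤⟨ +-monoʳ-≤ (4 * suc n) (+-monoʳ-≤ (4 * y) (m≤m+n 24 12)) ⟩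
  4 * suc n + (4 * y + 36)      ≡⟨ lem₂ n y ⟩
  4 * (n + 10) + 4 * y ∎))
  where
  open ≤-Reasoning
  lem₁ : ∀ x y k → 4 * (x + 2 * k) + 4 * y ≡ 4 * (x + y) + 8 * k
  lem₁ = solve-∀
  lem₂ : ∀ n y → 4 * suc n + (4 * y + 36) ≡ 4 * (n + 10) + 4 * y
  lem₂ = solve-∀

inner-bound : ∀ k n t → order t + 2 * k ≤ n + 10 → innerSum t + 2 * k * inner t ≤ (n + 10) * inner t
inner-bound k n t h = begin
  innerSum t + 2 * k * inner t          ≤⟨ +-monoˡ-≤ _ (innerSum≤ t) ⟩
  order t * inner t + 2 * k * inner t   ≡⟨ *-distribʳ-+ (inner t) (order t) (2 * k) ⟨
  (order t + 2 * k) * inner t           ≤⟨ *-monoˡ-≤ (inner t) h ⟩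
  (n + 10) * inner t ∎
  where open ≤-Reasoning

rooted-bound : ∀ k s t → 2 ^ k ≤ 4 * order s → 2 ^ k ≤ 4 * order t →
               rootedSum (s · t) + 2 * k * rooted (s · t) ≤ (order (s · t) + 10) * rooted (s · t)
rooted-bound k s t hs ht = begin
  rootedSum q + 2 * k * rooted q              ≤⟨ +-monoʳ-≤ (rootedSum q) deficit-large ⟩
  rootedSum q + (deficit q + 10 * rooted q)   ≡⟨ +-assoc (rootedSum q) (deficit q) _ ⟨
  rootedSum q + deficit q + 10 * rooted q     ≡⟨ cong (_+ 10 * rooted q) (rootedSum+deficit q) ⟩
  order q * rooted q + 10 * rooted q          ≡⟨ *-distribʳ-+ (rooted q) (order q) 10 ⟨
  (order q + 10) * rooted q ∎
  where
  open ≤-Reasoning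
  q : RTree
  q = s · t
  lem₁ : ∀ k a b → 2 * k * (a * b) ≡ b * (k * a) + a * (k * b)
  lem₁ = solve-∀
  lem₂ : ∀ a b x y → b * (x + 5 * a) + a * (y + 5 * b) ≡ b * x + a * y + 10 * (a * b)
  lem₂ = solve-∀
  deficit-large : 2 * k * rooted q ≤ deficit q + 10 * rooted q
  deficit-large = begin
    2 * k * rooted q                        ≡⟨ cong (2 * k *_) (rooted-· s t) ⟩
    2 * k * (rooted s * rooted t)           ≡⟨ lem₁ k (rooted s) (rooted t) ⟩
    rooted t * (k * rooted s) + rooted s * (k * rooted t)
      ≤⟨ +-mono-≤ (*-monoʳ-≤ (rooted t) (logBound⇒deficit k s hs)) (*-monoʳ-≤ (rooted s) (logBound⇒deficit k t ht)) ⟩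
    rooted t * (deficit s + 5 * rooted s) + rooted s * (deficit t + 5 * rooted t)
      ≡⟨ lem₂ (rooted s) (rooted t) (deficit s) (deficit t) ⟩
    rooted t * deficit s + rooted s * deficit t + 10 * (rooted s * rooted t)
      ≡⟨ cong₂ (λ x y → x + 10 * y) (deficit-· s t) (rooted-· s t) ⟨
    deficit q + 10 * rooted q ∎

-- Seen from the split vertex, a subtree either passes through it or lies inside one of the two
-- parts. The former lose 2k - 10 vertices on average, the latter lose that many each.
total-bound : ∀ k t → 2 ^ k ≤ order t →
              proj₂ (total t) + 2 * k * proj₁ (total t) ≤ (order t + 10) * proj₁ (total t)
total-bound k t h with balanced-split t
... | split x y eqn eqt x-large y-large = subst (λ p → proj₂ p + 2 * k * proj₁ p ≤ (order t + 10) * proj₁ p) (sym eqt) (begin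
  rootedSum q + innerSum q + 2 * k * (rooted q + inner q)
    ≡⟨ cong₂ (λ i j → rootedSum q + i + 2 * k * (rooted q + j)) (innerSum-· x y) (inner-· x y) ⟩
  rootedSum q + (innerSum x + innerSum y) + 2 * k * (rooted q + (inner x + inner y))
    ≡⟨ lem (rootedSum q) (innerSum x) (innerSum y) (2 * k) (rooted q) (inner x) (inner y) ⟩
  rootedSum q + 2 * k * rooted q + (innerSum x + 2 * k * inner x + (innerSum y + 2 * k * inner y))
    ≤⟨ +-mono-≤ (subst (λ m → rootedSum q + 2 * k * rooted q ≤ (m + 10) * rooted q) order-q
                   (rooted-bound k x y (≤-trans h x-large) (≤-trans h y-large)))
         (+-mono-≤ (inner-bound k n x (part-small k n (order x) (order y) h eqn y-large))
                   (inner-bound k n y (part-small k n (order y) (order x) h (trans eqn (+-comm (order x) (order y))) x-large))) ⟩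
  (n + 10) * rooted q + ((n + 10) * inner x + (n + 10) * inner y)
    ≡⟨ lem₂ (n + 10) (rooted q) (inner x) (inner y) ⟩
  (n + 10) * (rooted q + (inner x + inner y))
    ≡⟨ cong (λ j → (n + 10) * (rooted q + j)) (inner-· x y) ⟨
  (n + 10) * (rooted q + inner q) ∎)
  where
  open ≤-Reasoning
  n : ℕ
  n = order t
  q : RTree
  q = x · y
  order-q : order q ≡ n
  order-q = suc-injective (trans (order-· x y) (sym eqn))
  lem : ∀ r x y k a i j → r + (x + y) + k * (a + (i + j)) ≡ r + k * a + (x + k * i + (y + k * j))
  lem = solve-∀
  lem₂ : ∀ c a i j → c * a + (c * i + c * j) ≡ c * (a + (i + j))
  lem₂ = solve-∀

-- Batons

-- Both `leaf` and `above` attach one vertex to the current root and differ in which end is the root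
-- afterwards. A single graph operation, `pendant`, therefore realises both.
data Caterpillar : RTree → Set where
  vertex : Caterpillar ∙
  leaf   : ∀ {t} → Caterpillar t → Caterpillar (t ◁ ∙)
  above  : ∀ {t} → Caterpillar t → Caterpillar (∙ ◁ t)

addLeaves extendPath : ℕ → RTree → RTree

addLeaves zero    t = t
addLeaves (suc s) t = addLeaves s t ◁ ∙

extendPath zero    t = t
extendPath (suc k) t = ∙ ◁ extendPath k t

baton : ℕ → ℕ → RTree
baton s k = addLeaves s (extendPath k (addLeaves s ∙))

addLeaves-caterpillar : ∀ s {t} → Caterpillar t → Caterpillar (addLeaves s t)
addLeaves-caterpillar zero    c = c
addLeaves-caterpillar (suc s) c = leaf (addLeaves-caterpillar s c)

extendPath-caterpillar : ∀ k {t} → Caterpillar t → Caterpillar (extendPath k t)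
extendPath-caterpillar zero    c = c
extendPath-caterpillar (suc k) c = above (extendPath-caterpillar k c)

baton-caterpillar : ∀ s k → Caterpillar (baton s k)
baton-caterpillar s k = addLeaves-caterpillar s (extendPath-caterpillar k (addLeaves-caterpillar s vertex))

order-leaves : ∀ s t → order (addLeaves s t) ≡ s + order t
order-leaves zero    t = refl
order-leaves (suc s) t = trans (+-comm (order (addLeaves s t)) 1) (cong suc (order-leaves s t))

rooted-leaves : ∀ s t → rooted (addLeaves s t) ≡ 2 ^ s * rooted t
rooted-leaves zero    t = sym (+-identityʳ (rooted t))
rooted-leaves (suc s) t = trans (cong (_* 2) (rooted-leaves s t)) (lem (2 ^ s) (rooted t))
  where
  lem : ∀ p a → p * a * 2 ≡ 2 * p * a
  lem = solve-∀

-- Each leaf is absent from half of the subtrees through the root, so it adds 1/2 to the mean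
-- deficit.
deficit-leaves : ∀ s t → 2 * deficit (addLeaves s t) ≡ 2 ^ s * (2 * deficit t + s * rooted t)
deficit-leaves zero    t = lem (deficit t)
  where
  lem : ∀ d → 2 * d ≡ 1 * (2 * d + 0)
  lem = solve-∀
deficit-leaves (suc s) t = begin
  2 * (2 * deficit u + rooted u * 1)                    ≡⟨ lem₁ (deficit u) (rooted u) ⟩
  2 * (2 * deficit u) + 2 * rooted u                    ≡⟨ cong₂ (λ x y → 2 * x + 2 * y) (deficit-leaves s t) (rooted-leaves s t) ⟩
  2 * (2 ^ s * (2 * deficit t + s * rooted t)) + 2 * (2 ^ s * rooted t)
                                                        ≡⟨ lem₂ s (2 ^ s) (deficit t) (rooted t) ⟩
  2 ^ suc s * (2 * deficit t + suc s * rooted t) ∎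
  where
  open ≡-Reasoning
  u : RTree
  u = addLeaves s t
  lem₁ : ∀ d a → 2 * (2 * d + a * 1) ≡ 2 * (2 * d) + 2 * a
  lem₁ = solve-∀
  lem₂ : ∀ s p d a → 2 * (p * (2 * d + s * a)) + 2 * (p * a) ≡ 2 * p * (2 * d + suc s * a)
  lem₂ = solve-∀

inner-leaves : ∀ s t → inner (addLeaves s t) ≡ s + inner t
inner-leaves zero    t = refl
inner-leaves (suc s) t = trans (+-comm (inner (addLeaves s t)) 1) (cong suc (inner-leaves s t))

order-path : ∀ k t → order (extendPath k t) ≡ k + order t
order-path zero    t = refl
order-path (suc k) t = cong suc (order-path k t)

-- A subtree through the top either stops inside the path, in `k` ways, or reaches the root of `t`.
rooted-path : ∀ k t → rooted (extendPath k t) ≡ k + rooted t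
rooted-path zero    t = refl
rooted-path (suc k) t = cong suc (trans (+-identityʳ (rooted (extendPath k t))) (rooted-path k t))

inner-path : ∀ k t → inner (extendPath k t) ≤ inner t + k * (k + rooted t)
inner-path zero    t = ≤-reflexive (sym (+-identityʳ (inner t)))
inner-path (suc k) t = begin
  inner u + rooted u                                  ≤⟨ +-mono-≤ (inner-path k t) (≤-reflexive (rooted-path k t)) ⟩
  inner t + k * (k + rooted t) + (k + rooted t)       ≤⟨ m≤m+n _ (suc k) ⟩
  inner t + k * (k + rooted t) + (k + rooted t) + suc k ≡⟨ lem k (inner t) (rooted t) ⟩
  inner t + suc k * (suc k + rooted t) ∎
  where
  open ≤-Reasoning
  u : RTree
  u = extendPath k t
  lem : ∀ k m a → m + k * (k + a) + (k + a) + suc k ≡ m + suc k * (suc k + a)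
  lem = solve-∀

deficit-path : ∀ k t → deficit (extendPath k t) ≤ deficit t + k * (k + order t)
deficit-path zero    t = ≤-reflexive (sym (+-identityʳ (deficit t)))
deficit-path (suc k) t = begin
  suc (rooted u) * 0 + 1 * (deficit u + order u)      ≡⟨ lem₀ (rooted u) (deficit u) (order u) ⟩
  deficit u + order u                                 ≤⟨ +-mono-≤ (deficit-path k t) (≤-reflexive (order-path k t)) ⟩
  deficit t + k * (k + order t) + (k + order t)       ≤⟨ m≤m+n _ (suc k) ⟩
  deficit t + k * (k + order t) + (k + order t) + suc k ≡⟨ lem k (deficit t) (order t) ⟩
  deficit t + suc k * (suc k + order t) ∎
  where
  open ≤-Reasoning
  u : RTree
  u = extendPath k t
  lem₀ : ∀ a d n → suc a * 0 + 1 * (d + n) ≡ d + n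
  lem₀ = solve-∀
  lem : ∀ k m a → m + k * (k + a) + (k + a) + suc k ≡ m + suc k * (suc k + a)
  lem = solve-∀

order-baton : ∀ s k → order (baton s k) ≡ suc (s + s + k)
order-baton s k = begin
  order (baton s k)                       ≡⟨ order-leaves s _ ⟩
  s + order (extendPath k (addLeaves s ∙)) ≡⟨ cong (s +_) (order-path k _) ⟩
  s + (k + order (addLeaves s ∙))         ≡⟨ cong (λ n → s + (k + n)) (order-leaves s ∙) ⟩
  s + (k + (s + 1))                       ≡⟨ lem s k ⟩
  suc (s + s + k) ∎
  where
  open ≡-Reasoning
  lem : ∀ s k → s + (k + (s + 1)) ≡ suc (s + s + k)
  lem = solve-∀

rooted-baton : ∀ s k → rooted (baton s k) ≡ 2 ^ s * (k + 2 ^ s)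
rooted-baton s k = begin
  rooted (baton s k)                               ≡⟨ rooted-leaves s _ ⟩
  2 ^ s * rooted (extendPath k (addLeaves s ∙))    ≡⟨ cong (2 ^ s *_) (rooted-path k _) ⟩
  2 ^ s * (k + rooted (addLeaves s ∙))             ≡⟨ cong (λ a → 2 ^ s * (k + a)) (trans (rooted-leaves s ∙) (*-identityʳ (2 ^ s))) ⟩
  2 ^ s * (k + 2 ^ s) ∎
  where open ≡-Reasoning

inner-baton : ∀ s k → inner (baton s k) ≤ s + s + k * (k + 2 ^ s)
inner-baton s k = begin
  inner (baton s k)                        ≡⟨ inner-leaves s _ ⟩
  s + inner (extendPath k (addLeaves s ∙)) ≤⟨ +-monoʳ-≤ s (inner-path k _) ⟩
  s + (inner (addLeaves s ∙) + k * (k + rooted (addLeaves s ∙)))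
    ≡⟨ cong₂ (λ m a → s + (m + k * (k + a)))
         (trans (inner-leaves s ∙) (+-identityʳ s)) (trans (rooted-leaves s ∙) (*-identityʳ (2 ^ s))) ⟩
  s + (s + k * (k + 2 ^ s))                ≡⟨ +-assoc s s _ ⟨
  s + s + k * (k + 2 ^ s) ∎
  where open ≤-Reasoning

deficit-baton : ∀ s k → 2 * deficit (baton s k) ≤ 2 ^ s * (s * 2 ^ s + 2 * (k * (k + suc s)) + s * (k + 2 ^ s))
deficit-baton s k = begin
  2 * deficit (baton s k)
    ≡⟨ deficit-leaves s u ⟩
  2 ^ s * (2 * deficit u + s * rooted u)
    ≤⟨ *-monoʳ-≤ (2 ^ s) (+-mono-≤ (*-monoʳ-≤ 2 (deficit-path k v)) (≤-reflexive (cong (s *_) (rooted-path k v)))) ⟩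
  2 ^ s * (2 * (deficit v + k * (k + order v)) + s * (k + rooted v))
    ≡⟨ cong₂ (λ n a → 2 ^ s * (2 * (deficit v + k * (k + n)) + s * (k + a)))
         (trans (order-leaves s ∙) (+-comm s 1)) rooted-v ⟩
  2 ^ s * (2 * (deficit v + k * (k + suc s)) + s * (k + 2 ^ s))
    ≡⟨ cong (λ x → 2 ^ s * (x + s * (k + 2 ^ s))) (trans (*-distribˡ-+ 2 (deficit v) _) (cong (_+ 2 * (k * (k + suc s))) deficit-v)) ⟩
  2 ^ s * (s * 2 ^ s + 2 * (k * (k + suc s)) + s * (k + 2 ^ s)) ∎
  where
  open ≤-Reasoning
  v u : RTree
  v = addLeaves s ∙
  u = extendPath k v
  rooted-v : rooted v ≡ 2 ^ s
  rooted-v = trans (rooted-leaves s ∙) (*-identityʳ (2 ^ s))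
  lem : ∀ p s → p * (s * 1) ≡ s * p
  lem = solve-∀
  deficit-v : 2 * deficit v ≡ s * 2 ^ s
  deficit-v = trans (deficit-leaves s ∙) (lem (2 ^ s) s)

-- With `p` for `2 ^ s`, the two sets of leaves contribute s/2 each to the mean over the `p * p`
-- subtrees containing the whole path. The remaining terms are at most `p` times 3n², and
-- `n * n ≤ 4 * p` turns half of that into the 6.
baton-deficit-bound : ∀ s k n p → n ≡ suc (s + s + k) → n * n ≤ 4 * p →
  p * (s * p + 2 * (k * (k + suc s)) + s * (k + p)) ≤ 2 * ((s + 6) * (p * p))
baton-deficit-bound s k n p eq n²≤4p = begin
  p * (s * p + 2 * (k * (k + suc s)) + s * (k + p))   ≡⟨ lem₁ s k p (suc s) ⟩
  2 * (s * (p * p)) + p * (2 * (k * (k + suc s)) + s * k)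
    ≤⟨ +-monoʳ-≤ (2 * (s * (p * p))) (*-monoʳ-≤ p (+-mono-≤ (*-monoʳ-≤ 2 (*-mono-≤ k≤n k+s≤n)) (*-mono-≤ s≤n k≤n))) ⟩
  2 * (s * (p * p)) + p * (2 * (n * n) + n * n)
    ≤⟨ +-monoʳ-≤ (2 * (s * (p * p))) (*-monoʳ-≤ p (+-mono-≤ (*-monoʳ-≤ 2 n²≤4p) n²≤4p)) ⟩
  2 * (s * (p * p)) + p * (2 * (4 * p) + 4 * p)       ≡⟨ lem₂ s p ⟩
  2 * ((s + 6) * (p * p)) ∎
  where
  open ≤-Reasoning
  lem₁ : ∀ s k p q → p * (s * p + 2 * (k * (k + q)) + s * (k + p)) ≡ 2 * (s * (p * p)) + p * (2 * (k * (k + q)) + s * k)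
  lem₁ = solve-∀
  lem₂ : ∀ s p → 2 * (s * (p * p)) + p * (2 * (4 * p) + 4 * p) ≡ 2 * ((s + 6) * (p * p))
  lem₂ = solve-∀
  k≤n : k ≤ n
  k≤n = subst (k ≤_) (sym eq) (≤-trans (m≤n+m k (s + s)) (n≤1+n _))
  s≤n : s ≤ n
  s≤n = subst (s ≤_) (sym eq) (≤-trans (≤-trans (m≤m+n s s) (m≤m+n (s + s) k)) (n≤1+n _))
  k+s≤n : k + suc s ≤ n
  k+s≤n = subst (k + suc s ≤_) (sym eq) (≤-trans (≤-reflexive (+-comm k (suc s))) (s≤s (+-monoˡ-≤ k (m≤m+n s s))))

-- The 24 is 4 + 16 + 4, from bounding the terms n², n⁴ and n²p by means of `n * n ≤ 4 * p`.
baton-inner-bound : ∀ s k n p .{{_ : NonZero p}} → n ≡ suc (s + s + k) → n * n ≤ 4 * p →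
  n * (s + s + k * (k + p)) ≤ 24 * (p * p)
baton-inner-bound s k n p eq n²≤4p = begin
  n * (s + s + k * (k + p))               ≤⟨ *-monoʳ-≤ n (+-mono-≤ 2s≤n (*-mono-≤ k≤n (+-monoˡ-≤ p k≤n))) ⟩
  n * (n + n * (n + p))                   ≡⟨ lem₁ n p ⟩
  n * n + n * n * n + n * n * p           ≤⟨ +-monoˡ-≤ (n * n * p) (+-monoʳ-≤ (n * n) (*-monoʳ-≤ (n * n) n≤n²)) ⟩
  n * n + n * n * (n * n) + n * n * p     ≤⟨ +-mono-≤ (+-mono-≤ n²≤4p (*-mono-≤ n²≤4p n²≤4p)) (*-monoˡ-≤ p n²≤4p) ⟩
  4 * p + 4 * p * (4 * p) + 4 * p * p     ≤⟨ +-monoˡ-≤ (4 * p * p) (+-monoˡ-≤ (4 * p * (4 * p)) (*-monoʳ-≤ 4 (m≤m*n p p))) ⟩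
  4 * (p * p) + 4 * p * (4 * p) + 4 * p * p ≡⟨ lem₂ p ⟩
  24 * (p * p) ∎
  where
  open ≤-Reasoning
  lem₁ : ∀ n p → n * (n + n * (n + p)) ≡ n * n + n * n * n + n * n * p
  lem₁ = solve-∀
  lem₂ : ∀ p → 4 * (p * p) + 4 * p * (4 * p) + 4 * p * p ≡ 24 * (p * p)
  lem₂ = solve-∀
  k≤n : k ≤ n
  k≤n = subst (k ≤_) (sym eq) (≤-trans (m≤n+m k (s + s)) (n≤1+n _))
  2s≤n : s + s ≤ n
  2s≤n = subst (s + s ≤_) (sym eq) (≤-trans (m≤m+n (s + s) k) (n≤1+n _))
  n≤n² : n ≤ n * n
  n≤n² = subst (λ m → m ≤ m * m) (sym eq) (m≤m*n (suc (s + s + k)) (suc (s + s + k)))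

-- Each subtree avoiding the root is charged the full `order t`, as if it had no vertices; so
-- `innerSum` only has to be nonnegative.
mean-large : ∀ c t → deficit t + order t * inner t ≤ c * rooted t →
             order t * proj₁ (total t) ≤ proj₂ (total t) + c * proj₁ (total t)
mean-large c t h = begin
  order t * (rooted t + inner t)                      ≡⟨ *-distribˡ-+ (order t) (rooted t) (inner t) ⟩
  order t * rooted t + order t * inner t              ≡⟨ cong (_+ order t * inner t) (rootedSum+deficit t) ⟨
  rootedSum t + deficit t + order t * inner t         ≡⟨ +-assoc (rootedSum t) (deficit t) _ ⟩
  rootedSum t + (deficit t + order t * inner t)
    ≤⟨ +-mono-≤ (m≤m+n (rootedSum t) (innerSum t)) (≤-trans h (*-monoʳ-≤ c (m≤m+n (rooted t) (inner t)))) ⟩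
  rootedSum t + innerSum t + c * (rooted t + inner t) ∎
  where open ≤-Reasoning

baton-mean : ∀ s k → order (baton s k) * order (baton s k) ≤ 4 * 2 ^ s →
  order (baton s k) * proj₁ (total (baton s k)) ≤ proj₂ (total (baton s k)) + (s + 30) * proj₁ (total (baton s k))
baton-mean s k n²≤4p = mean-large (s + 30) b (begin
  deficit b + order b * inner b             ≤⟨ +-mono-≤ d≤ (≤-trans (*-monoʳ-≤ (order b) (inner-baton s k))
                                                 (baton-inner-bound s k (order b) p {{m^n≢0 2 s}} (order-baton s k) n²≤4p)) ⟩
  (s + 6) * (p * p) + 24 * (p * p)          ≡⟨ lem s (p * p) ⟩
  (s + 30) * (p * p)                        ≤⟨ *-monoʳ-≤ (s + 30) (*-monoʳ-≤ p (m≤n+m p k)) ⟩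
  (s + 30) * (p * (k + p))                  ≡⟨ cong ((s + 30) *_) (rooted-baton s k) ⟨
  (s + 30) * rooted b ∎)
  where
  open ≤-Reasoning
  b : RTree
  b = baton s k
  p : ℕ
  p = 2 ^ s
  lem : ∀ s q → (s + 6) * q + 24 * q ≡ (s + 30) * q
  lem = solve-∀
  d≤ : deficit b ≤ (s + 6) * (p * p)
  d≤ = *-cancelˡ-≤ 2 (≤-trans (deficit-baton s k) (baton-deficit-bound s k (order b) p (order-baton s k) n²≤4p))

-- Each end carries s = 2 l leaves, so that 2 ^ s is about n²; the constant 30 absorbs the small n
-- for which this many leaves do not fit.
good-caterpillar : ∀ l n → 2 ^ l ≤ n → n < 2 ^ suc l →
  ∃[ t ] Caterpillar t × order t ≡ n × n * proj₁ (total t) ≤ proj₂ (total t) + (2 * l + 30) * proj₁ (total t)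
good-caterpillar l zero    2^l≤n _ = contradiction 2^l≤n (<⇒≱ (m^n>0 2 l))
good-caterpillar l (suc m) 2^l≤n n<2^1+l with 2 * l + 2 * l ≤? m
... | yes 4l≤m = baton s k , baton-caterpillar s k , order≡ ,
    subst (λ n → n * proj₁ (total (baton s k)) ≤ proj₂ (total (baton s k)) + (s + 30) * proj₁ (total (baton s k)))
      order≡ (baton-mean s k (subst (λ n → n * n ≤ 4 * 2 ^ s) (sym order≡) n²≤))
  where
  open ≤-Reasoning
  s k : ℕ
  s = 2 * l
  k = m ∸ (s + s)
  order≡ : order (baton s k) ≡ suc m
  order≡ = trans (order-baton s k) (cong suc (m+[n∸m]≡n 4l≤m))
  lem : ∀ p → 2 * p * (2 * p) ≡ 4 * (p * p)
  lem = solve-∀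
  n²≤ : suc m * suc m ≤ 4 * 2 ^ s
  n²≤ = begin
    suc m * suc m               ≤⟨ *-mono-≤ (<⇒≤ n<2^1+l) (<⇒≤ n<2^1+l) ⟩
    2 * 2 ^ l * (2 * 2 ^ l)     ≡⟨ lem (2 ^ l) ⟩
    4 * (2 ^ l * 2 ^ l)         ≡⟨ cong (4 *_) (^-distribˡ-+-* 2 l l) ⟨
    4 * 2 ^ (l + l)             ≡⟨ cong (λ j → 4 * 2 ^ (l + j)) (+-identityʳ l) ⟨
    4 * 2 ^ s ∎
-- Here `n ≤ 30`, so the bound asks for nothing positive and any caterpillar of the right order
-- serves; a path is taken.
... | no 4l≰m = baton 0 m , baton-caterpillar 0 m , order-baton 0 m ,
    ≤-trans (*-monoˡ-≤ (proj₁ (total (baton 0 m))) (≤-trans n≤30 (m≤n+m 30 (2 * l)))) (m≤n+m _ (proj₂ (total (baton 0 m))))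
  where
  open ≤-Reasoning
  n≤4l : suc m ≤ 4 * l
  n≤4l = ≤-trans (≰⇒> 4l≰m) (≤-reflexive (lem l))
    where
    lem : ∀ l → 2 * l + 2 * l ≡ 4 * l
    lem = solve-∀
  4l≤24 : 4 * l ≤ 24
  4l≤24 = +-cancelˡ-≤ (4 * l) _ _ (begin
    4 * l + 4 * l   ≡⟨ lem l ⟩
    8 * l           ≤⟨ 8k≤2^k+24 l ⟩
    2 ^ l + 24      ≤⟨ +-monoˡ-≤ 24 (≤-trans 2^l≤n n≤4l) ⟩
    4 * l + 24 ∎)
    where
    lem : ∀ l → 4 * l + 4 * l ≡ 8 * l
    lem = solve-∀
  n≤30 : suc m ≤ 30
  n≤30 = ≤-trans n≤4l (≤-trans 4l≤24 (m≤m+n 24 6))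

-- Enumerating subtrees

private variable
  n : ℕ

Disjoint : Subset n → Subset n → Set
Disjoint U V = ∀ {x} → x ∈ U → x ∉ V

size-∪ : (p q : Subset n) → Disjoint p q → size (p ∪ q) ≡ size p + size q
size-∪ []            []            _    = refl
size-∪ (outside ∷ p) (outside ∷ q) disj = size-∪ p q λ x∈p x∈q → disj (there x∈p) (there x∈q)
size-∪ (outside ∷ p) (inside ∷ q)  disj = trans (cong suc (size-∪ p q λ x∈p x∈q → disj (there x∈p) (there x∈q)))
                                                (sym (+-suc (size p) (size q)))
size-∪ (inside ∷ p)  (outside ∷ q) disj = cong suc (size-∪ p q λ x∈p x∈q → disj (there x∈p) (there x∈q))
size-∪ (inside ∷ p)  (inside ∷ q)  disj = contradiction here (disj here)

∪-⊆ : {p q r : Subset n} → p ⊆ r → q ⊆ r → p ∪ q ⊆ r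
∪-⊆ {p = p} {q} p⊆r q⊆r x∈ with x∈p∪q⁻ p q x∈
... | inj₁ x∈p = p⊆r x∈p
... | inj₂ x∈q = q⊆r x∈q

⊆-∪ˡ : {S : Subset n} (U V : Subset n) → S ⊆ U → S ⊆ U ∪ V
⊆-∪ˡ U V S⊆U x∈ = p⊆p∪q V (S⊆U x∈)

⊆-∪ʳ : {S : Subset n} (U V : Subset n) → S ⊆ V → S ⊆ U ∪ V
⊆-∪ʳ U V S⊆V x∈ = q⊆p∪q U V (S⊆V x∈)

swap-⊆ : {S : Subset n} (U V : Subset n) → S ⊆ U ∪ V → S ⊆ V ∪ U
swap-⊆ U V S⊆ x∈ = subst (_ ∈_) (∪-comm U V) (S⊆ x∈)

∩-cover : {S : Subset n} (U V : Subset n) → S ⊆ U ∪ V → S ≡ (S ∩ U) ∪ (S ∩ V)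
∩-cover {S = S} U V S⊆ = ⊆-antisym cover (∪-⊆ {p = S ∩ U} {S ∩ V} (p∩q⊆p S U) (p∩q⊆p S V))
  where
  cover : S ⊆ (S ∩ U) ∪ (S ∩ V)
  cover x∈S with x∈p∪q⁻ U V (S⊆ x∈S)
  ... | inj₁ x∈U = x∈p∪q⁺ (inj₁ (x∈p∩q⁺ (x∈S , x∈U)))
  ... | inj₂ x∈V = x∈p∪q⁺ (inj₂ (x∈p∩q⁺ (x∈S , x∈V)))

nonempty-apart : {U V S : Subset n} → Disjoint U V → Nonempty S → S ⊆ U → S ⊆ V → ⊥
nonempty-apart disj (x , x∈S) S⊆U S⊆V = disj (S⊆U x∈S) (S⊆V x∈S)

-- The fields match a witness of `MeanSubtreeOrder`. Count and total size are indices so that they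
-- can follow the recursions on `RTree`.
record Enumeration {n : ℕ} (P : Subset n → Set) (len tot : ℕ) : Set where
  field
    list     : List (Subset n)
    unique   : Unique list
    complete : ∀ S → (S LM.∈ list) ⇔ P S
    length≡  : length list ≡ len
    sum≡     : sum (map size list) ≡ tot

open Enumeration

to : ∀ {A B : Set} → A ⇔ B → A → B
to = Equivalence.to

from : ∀ {A B : Set} → A ⇔ B → B → A
from = Equivalence.from

enum-⇔ : {P Q : Subset n → Set} {a x : ℕ} → (∀ S → P S ⇔ Q S) → Enumeration P a x → Enumeration Q a x
enum-⇔ P⇔Q e = record
  { list     = list e
  ; unique   = unique e
  ; complete = λ S → mk⇔ (to (P⇔Q S) ∘ to (complete e S)) (from (complete e S) ∘ from (P⇔Q S))
  ; length≡  = length≡ e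
  ; sum≡     = sum≡ e
  }

enum-⊎ : {P Q : Subset n → Set} {a b x y : ℕ} → (∀ S → P S → Q S → ⊥) →
         Enumeration P a x → Enumeration Q b y → Enumeration (λ S → P S ⊎ Q S) (a + b) (x + y)
enum-⊎ {P = P} {Q} disj e f = record
  { list     = list e ++ list f
  ; unique   = Unique.++⁺ (unique e) (unique f) λ (S∈e , S∈f) → disj _ (to (complete e _) S∈e) (to (complete f _) S∈f)
  ; complete = λ S → mk⇔ (forwards S) (backwards S)
  ; length≡  = trans (length-++ (list e)) (cong₂ _+_ (length≡ e) (length≡ f))
  ; sum≡     = trans (cong sum (map-++ size (list e) (list f)))
                 (trans (sum-++ (map size (list e)) (map size (list f))) (cong₂ _+_ (sum≡ e) (sum≡ f)))
  }
  where
  forwards : ∀ S → S LM.∈ list e ++ list f → P S ⊎ Q S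
  forwards S S∈ with ∈-++⁻ (list e) S∈
  ... | inj₁ S∈e = inj₁ (to (complete e S) S∈e)
  ... | inj₂ S∈f = inj₂ (to (complete f S) S∈f)
  backwards : ∀ S → P S ⊎ Q S → S LM.∈ list e ++ list f
  backwards S (inj₁ p) = ∈-++⁺ˡ (from (complete e S) p)
  backwards S (inj₂ q) = ∈-++⁺ʳ (list e) (from (complete f S) q)

module _ {n : ℕ} {U V : Subset n} (disj : Disjoint U V) where

  ∪-injective : ∀ {p q p′ q′} → p ⊆ U → q ⊆ V → p′ ⊆ U → q′ ⊆ V → p ∪ q ≡ p′ ∪ q′ → p ≡ p′ × q ≡ q′
  ∪-injective {p} {q} {p′} {q′} p⊆U q⊆V p′⊆U q′⊆V eq =
    ⊆-antisym (left p⊆U q′⊆V (subst (_ ∈_) eq ∘ x∈p∪q⁺ ∘ inj₁)) (left p′⊆U q⊆V (subst (_ ∈_) (sym eq) ∘ x∈p∪q⁺ ∘ inj₁)) ,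
    ⊆-antisym (right q⊆V p′⊆U (subst (_ ∈_) eq ∘ x∈p∪q⁺ ∘ inj₂)) (right q′⊆V p⊆U (subst (_ ∈_) (sym eq) ∘ x∈p∪q⁺ ∘ inj₂))
    where
    left : ∀ {r s t} → r ⊆ U → t ⊆ V → (∀ {x} → x ∈ r → x ∈ s ∪ t) → r ⊆ s
    left {s = s} {t} r⊆U t⊆V h x∈r with x∈p∪q⁻ s t (h x∈r)
    ... | inj₁ x∈s = x∈s
    ... | inj₂ x∈t = contradiction (t⊆V x∈t) (disj (r⊆U x∈r))
    right : ∀ {r s t} → r ⊆ V → s ⊆ U → (∀ {x} → x ∈ r → x ∈ s ∪ t) → r ⊆ t
    right {s = s} {t} r⊆V s⊆U h x∈r with x∈p∪q⁻ s t (h x∈r)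
    ... | inj₁ x∈s = contradiction (r⊆V x∈r) (disj (s⊆U x∈s))
    ... | inj₂ x∈t = x∈t

  map-∪-unique : ∀ {p qs} → p ⊆ U → All (_⊆ V) qs → Unique qs → Unique (map (p ∪_) qs)
  map-∪-unique p⊆U []           []           = []
  map-∪-unique {p} p⊆U (q⊆V ∷ qs⊆V) (q∉qs ∷ uniq) = fresh q⊆V qs⊆V q∉qs ∷ map-∪-unique p⊆U qs⊆V uniq
    where
    fresh : ∀ {q qs} → q ⊆ V → All (_⊆ V) qs → All (q ≢_) qs → All (p ∪ q ≢_) (map (p ∪_) qs)
    fresh _   []           []             = []
    fresh q⊆V (q′⊆V ∷ qs⊆V) (q≢q′ ∷ q∉qs) =
      (λ eq → q≢q′ (proj₂ (∪-injective p⊆U q⊆V p⊆U q′⊆V eq))) ∷ fresh q⊆V qs⊆V q∉qs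

  product-unique : ∀ {ps qs} → All (_⊆ U) ps → All (_⊆ V) qs → Unique ps → Unique qs →
                   Unique (cartesianProductWith _∪_ ps qs)
  product-unique []           _    []            _  = []
  product-unique {p ∷ ps} {qs} (p⊆U ∷ ps⊆U) qs⊆V (p∉ps ∷ uniq) uniq′ =
    Unique.++⁺ (map-∪-unique p⊆U qs⊆V uniq′) (product-unique ps⊆U qs⊆V uniq uniq′) apart
    where
    apart : ∀ {S} → S LM.∈ map (p ∪_) qs × S LM.∈ cartesianProductWith _∪_ ps qs → ⊥
    apart (S∈₁ , S∈₂) with ∈-map⁻ (p ∪_) S∈₁ | ∈-cartesianProductWith⁻ _∪_ ps qs S∈₂
    ... | q , q∈qs , eq | p′ , q′ , p′∈ps , q′∈qs , eq′ = All.lookup p∉ps p′∈ps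
          (proj₁ (∪-injective p⊆U (All.lookup qs⊆V q∈qs) (All.lookup ps⊆U p′∈ps) (All.lookup qs⊆V q′∈qs) (trans (sym eq) eq′)))

  size-map-∪ : ∀ {p qs} → p ⊆ U → All (_⊆ V) qs → sum (map size (map (p ∪_) qs)) ≡ length qs * size p + sum (map size qs)
  size-map-∪ p⊆U [] = refl
  size-map-∪ {p} {q ∷ qs} p⊆U (q⊆V ∷ qs⊆V) =
    trans (cong₂ _+_ (size-∪ p q (λ x∈p x∈q → disj (p⊆U x∈p) (q⊆V x∈q))) (size-map-∪ p⊆U qs⊆V))
          (lem (size p) (size q) (length qs * size p) (sum (map size qs)))
    where
    lem : ∀ a b c d → a + b + (c + d) ≡ a + c + (b + d)
    lem = solve-∀

  size-product : ∀ {ps qs} → All (_⊆ U) ps → All (_⊆ V) qs → sum (map size (cartesianProductWith _∪_ ps qs))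
                 ≡ length qs * sum (map size ps) + length ps * sum (map size qs)
  size-product {qs = qs} [] qs⊆V = sym (trans (+-identityʳ _) (*-zeroʳ (length qs)))
  size-product {p ∷ ps} {qs} (p⊆U ∷ ps⊆U) qs⊆V = begin
    sum (map size (map (p ∪_) qs ++ rest))
      ≡⟨ cong sum (map-++ size (map (p ∪_) qs) rest) ⟩
    sum (map size (map (p ∪_) qs) ++ map size rest)
      ≡⟨ sum-++ (map size (map (p ∪_) qs)) (map size rest) ⟩
    sum (map size (map (p ∪_) qs)) + sum (map size rest)
      ≡⟨ cong₂ _+_ (size-map-∪ p⊆U qs⊆V) (size-product ps⊆U qs⊆V) ⟩
    length qs * size p + sum (map size qs) + (length qs * sum (map size ps) + length ps * sum (map size qs))
      ≡⟨ lem (length qs) (size p) (sum (map size qs)) (sum (map size ps)) (length ps) ⟩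
    length qs * (size p + sum (map size ps)) + suc (length ps) * sum (map size qs) ∎
    where
    open ≡-Reasoning
    rest : List (Subset n)
    rest = cartesianProductWith _∪_ ps qs
    lem : ∀ l a y x k → l * a + y + (l * x + k * y) ≡ l * (a + x) + suc k * y
    lem = solve-∀

  length-product : ∀ (ps qs : List (Subset n)) → length (cartesianProductWith _∪_ ps qs) ≡ length ps * length qs
  length-product []       qs = refl
  length-product (p ∷ ps) qs = trans (length-++ (map (p ∪_) qs)) (cong₂ _+_ (length-map (p ∪_) qs) (length-product ps qs))

  -- Since `U` and `V` are disjoint, a union determines both of its parts. The product list
  -- therefore has no repetitions, and sizes add.
  enum-∪ : {P Q : Subset n → Set} {a b x y : ℕ} → (∀ S → P S → S ⊆ U) → (∀ S → Q S → S ⊆ V) →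
           Enumeration P a x → Enumeration Q b y →
           Enumeration (λ S → ∃[ S₁ ] ∃[ S₂ ] P S₁ × Q S₂ × S ≡ S₁ ∪ S₂) (a * b) (b * x + a * y)
  enum-∪ {P} {Q} P⊆U Q⊆V e f = record
    { list     = cartesianProductWith _∪_ (list e) (list f)
    ; unique   = product-unique e⊆U f⊆V (unique e) (unique f)
    ; complete = λ S → mk⇔ (forwards S) backwards
    ; length≡  = trans (length-product (list e) (list f)) (cong₂ _*_ (length≡ e) (length≡ f))
    ; sum≡     = trans (size-product e⊆U f⊆V)
                   (cong₂ _+_ (cong₂ _*_ (length≡ f) (sum≡ e)) (cong₂ _*_ (length≡ e) (sum≡ f)))
    }
    where
    e⊆U : All (_⊆ U) (list e)
    e⊆U = All.tabulate λ S∈ → P⊆U _ (to (complete e _) S∈)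
    f⊆V : All (_⊆ V) (list f)
    f⊆V = All.tabulate λ S∈ → Q⊆V _ (to (complete f _) S∈)
    forwards : ∀ S → S LM.∈ cartesianProductWith _∪_ (list e) (list f) → ∃[ S₁ ] ∃[ S₂ ] P S₁ × Q S₂ × S ≡ S₁ ∪ S₂
    forwards S S∈ with ∈-cartesianProductWith⁻ _∪_ (list e) (list f) S∈
    ... | S₁ , S₂ , S₁∈ , S₂∈ , eq = S₁ , S₂ , to (complete e S₁) S₁∈ , to (complete f S₂) S₂∈ , eq
    backwards : ∀ {S} → ∃[ S₁ ] ∃[ S₂ ] P S₁ × Q S₂ × S ≡ S₁ ∪ S₂ → S LM.∈ cartesianProductWith _∪_ (list e) (list f)
    backwards (S₁ , S₂ , p , q , refl) = ∈-cartesianProductWith⁺ _∪_ (from (complete e S₁) p) (from (complete f S₂) q)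

-- Two lists without repetitions and with the same members are permutations of each other. Hence the
-- mean does not depend on the list chosen in `MeanSubtreeOrder`.
enum-unique : {P : Subset n → Set} {a b x y : ℕ} → Enumeration P a x → Enumeration P b y → a ≡ b × x ≡ y
enum-unique e f =
  trans (sym (length≡ e)) (trans (Perm.↭-length e↭f) (length≡ f)) ,
  trans (sym (sum≡ e)) (trans (sum-↭ (Perm.map⁺ size e↭f)) (sum≡ f))
  where
  e↭f : list e ↭ list f
  e↭f = ∼bag⇒↭ (unique∧set⇒bag (unique e) (unique f)
          (mk⇔ (from (complete f _) ∘ to (complete e _)) (from (complete e _) ∘ to (complete f _))))

-- Subtrees of a graph glued along bridges

-- U carries the tree t rooted at r: two disjoint parts are joined by their only common edge.
data Decomposition {n : ℕ} (G : Graph n) : Fin n → Subset n → RTree → Set where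
  single : ∀ r → Decomposition G r ⁅ r ⁆ ∙
  join   : ∀ {u v U V s t} → Decomposition G u U s → Decomposition G v V t → Disjoint U V → adj G u v ≡ true →
           (∀ {x y} → x ∈ U → y ∈ V → adj G x y ≡ true → x ≡ u × y ≡ v) → Decomposition G u (U ∪ V) (s ◁ t)

module _ {n : ℕ} {G : Graph n} where

  root∈ : ∀ {r U t} → Decomposition G r U t → r ∈ U
  root∈ (single r)       = x∈⁅x⁆ r
  root∈ (join d _ _ _ _) = x∈p∪q⁺ (inj₁ (root∈ d))

  size-decomposition : ∀ {r U t} → Decomposition G r U t → size U ≡ order t
  size-decomposition (single r) = ∣⁅x⁆∣≡1 r
  size-decomposition (join {U = U} {V} d e disj _ _) = trans (size-∪ U V disj) (cong₂ _+_ (size-decomposition d) (size-decomposition e))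

  walk-mono : ∀ {S S′ x y} → S ⊆ S′ → Walk G S x y → Walk G S′ x y
  walk-mono S⊆ (stay x∈)       = stay (S⊆ x∈)
  walk-mono S⊆ (step x∈ a w) = step (S⊆ x∈) a (walk-mono S⊆ w)

  walk-++ : ∀ {S x y z} → Walk G S x y → Walk G S y z → Walk G S x z
  walk-++ (stay _)       w = w
  walk-++ (step x∈ a v) w = step x∈ a (walk-++ v w)

  walk-start : ∀ {S x y} → Walk G S x y → x ∈ S
  walk-start (stay x∈)     = x∈
  walk-start (step x∈ _ _) = x∈

  connected-join : ∀ {S₁ S₂ u v} → InducedConnected G S₁ → InducedConnected G S₂ → u ∈ S₁ → v ∈ S₂ → adj G u v ≡ true →
                   InducedConnected G (S₁ ∪ S₂)
  connected-join {S₁} {S₂} {u} {v} c₁ c₂ u∈ v∈ uv x y x∈ y∈ with x∈p∪q⁻ S₁ S₂ x∈ | x∈p∪q⁻ S₁ S₂ y∈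
  ... | inj₁ x∈₁ | inj₁ y∈₁ = walk-mono (p⊆p∪q S₂) (c₁ x y x∈₁ y∈₁)
  ... | inj₂ x∈₂ | inj₂ y∈₂ = walk-mono (q⊆p∪q S₁ S₂) (c₂ x y x∈₂ y∈₂)
  ... | inj₁ x∈₁ | inj₂ y∈₂ = walk-++ (walk-mono (p⊆p∪q S₂) (c₁ x u x∈₁ u∈))
                                (step (p⊆p∪q S₂ u∈) uv (walk-mono (q⊆p∪q S₁ S₂) (c₂ v y v∈ y∈₂)))
  ... | inj₂ x∈₂ | inj₁ y∈₁ = walk-++ (walk-mono (q⊆p∪q S₁ S₂) (c₂ x v x∈₂ v∈))
                                (step (q⊆p∪q S₁ S₂ v∈) (trans (Graph.sym G v u) uv) (walk-mono (p⊆p∪q S₂) (c₁ u y u∈ y∈₁)))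

  singleton-connected : ∀ r → InducedConnected G ⁅ r ⁆
  singleton-connected r x y x∈ y∈ with x∈⁅y⁆⇒x≡y r x∈ | x∈⁅y⁆⇒x≡y r y∈
  ... | refl | refl = stay x∈

  decomposition-connected : ∀ {r U t} → Decomposition G r U t → InducedConnected G U
  decomposition-connected (single r)        = singleton-connected r
  decomposition-connected (join d e _ uv _) =
    connected-join (decomposition-connected d) (decomposition-connected e) (root∈ d) (root∈ e) uv

  Rooted Inner : Fin n → Subset n → Subset n → Set
  Rooted r U S = IsSubtree G S × S ⊆ U × r ∈ S
  Inner  r U S = IsSubtree G S × S ⊆ U × r ∉ S

  module _ {u v : Fin n} {U V : Subset n} (u∈U : u ∈ U) (v∈V : v ∈ V) (disj : Disjoint U V) (uv : adj G u v ≡ true)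
           (only : ∀ {x y} → x ∈ U → y ∈ V → adj G x y ≡ true → x ≡ u × y ≡ v) where

    only′ : ∀ {x y} → x ∈ V → y ∈ U → adj G x y ≡ true → x ≡ v × y ≡ u
    only′ {x} {y} x∈V y∈U xy with only y∈U x∈V (trans (Graph.sym G y x) xy)
    ... | y≡u , x≡v = x≡v , y≡u

    -- The first step out of `U` can only be along the bridge, so the walk visits both of its ends.
    crossing : ∀ {S x y} → S ⊆ U ∪ V → Walk G S x y → x ∈ U → y ∈ V → u ∈ S × v ∈ S
    crossing S⊆ (stay _) x∈U y∈V = contradiction y∈V (disj x∈U)
    crossing S⊆ (step x∈S xw w) x∈U y∈V with x∈p∪q⁻ U V (S⊆ (walk-start w))
    ... | inj₁ w∈U = crossing S⊆ w w∈U y∈V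
    ... | inj₂ w∈V with only x∈U w∈V xw
    ...   | refl , refl = x∈S , walk-start w

    -- An excursion from U into V leaves and returns through u, so it can be cut out.
    retract : ∀ {S x y} → S ⊆ U ∪ V → Walk G S x y → y ∈ U →
              (x ∈ U → Walk G (S ∩ U) x y) × (x ∈ V → Walk G (S ∩ U) u y)
    retract S⊆ (stay x∈S) y∈U = (λ x∈U → stay (x∈p∩q⁺ (x∈S , x∈U))) , λ x∈V → contradiction x∈V (disj y∈U)
    retract {S} {x} {y} S⊆ (step x∈S xw w) y∈U with retract S⊆ w y∈U | x∈p∪q⁻ U V (S⊆ (walk-start w))
    ... | inU , inV | inj₁ w∈U = (λ x∈U → step (x∈p∩q⁺ (x∈S , x∈U)) xw (inU w∈U)) ,
                                 λ x∈V → subst (λ z → Walk G (S ∩ U) z y) (proj₂ (only′ x∈V w∈U xw)) (inU w∈U)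
    ... | inU , inV | inj₂ w∈V = (λ x∈U → subst (λ z → Walk G (S ∩ U) z y) (sym (proj₁ (only x∈U w∈V xw))) (inV w∈V)) ,
                                 λ x∈V → inV w∈V

    restrict-connected : ∀ {S} → S ⊆ U ∪ V → InducedConnected G S → InducedConnected G (S ∩ U)
    restrict-connected {S} S⊆ c x y x∈ y∈ with x∈p∩q⁻ S U x∈ | x∈p∩q⁻ S U y∈
    ... | x∈S , x∈U | y∈S , y∈U = proj₁ (retract S⊆ (c x y x∈S y∈S) y∈U) x∈U

    ⊆-part : ∀ {S} → S ⊆ U ∪ V → (∀ {x} → x ∈ S → x ∉ V) → S ⊆ U
    ⊆-part S⊆ S∩V x∈S with x∈p∪q⁻ U V (S⊆ x∈S)
    ... | inj₁ x∈U = x∈U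
    ... | inj₂ x∈V = contradiction x∈V (S∩V x∈S)

  -- The parameters are taken anew because the lemmas above are applied in both orientations of the
  -- bridge.
  module _ {u v : Fin n} {U V : Subset n} (u∈U : u ∈ U) (v∈V : v ∈ V) (disj : Disjoint U V) (uv : adj G u v ≡ true)
           (only : ∀ {x y} → x ∈ U → y ∈ V → adj G x y ≡ true → x ≡ u × y ≡ v) where

    disjᵒ : Disjoint V U
    disjᵒ x∈V x∈U = disj x∈U x∈V

    uvᵒ : adj G v u ≡ true
    uvᵒ = trans (Graph.sym G v u) uv

    onlyᵒ : ∀ {x y} → x ∈ V → y ∈ U → adj G x y ≡ true → x ≡ v × y ≡ u
    onlyᵒ = only′ u∈U v∈V disj uv only

    Glued : Subset n → Set
    Glued S = ∃[ S₁ ] ∃[ S₂ ] Rooted u U S₁ × Rooted v V S₂ × S ≡ S₁ ∪ S₂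

    -- A subtree through `u` that meets `V` contains `v` by `crossing`, and each of its two traces
    -- stays connected by `restrict-connected`.
    rooted-join : ∀ S → (Rooted u U S ⊎ Glued S) ⇔ Rooted u (U ∪ V) S
    rooted-join S = mk⇔ forwards backwards
      where
      forwards : Rooted u U S ⊎ Glued S → Rooted u (U ∪ V) S
      forwards (inj₁ (sub , S⊆U , u∈S)) = sub , ⊆-∪ˡ U V S⊆U , u∈S
      forwards (inj₂ (S₁ , S₂ , ((_ , c₁) , S₁⊆U , u∈S₁) , ((_ , c₂) , S₂⊆V , v∈S₂) , refl)) =
        ((u , p⊆p∪q S₂ u∈S₁) , connected-join c₁ c₂ u∈S₁ v∈S₂ uv) ,
        ∪-⊆ {p = S₁} {S₂} (⊆-∪ˡ U V S₁⊆U) (⊆-∪ʳ U V S₂⊆V) , p⊆p∪q S₂ u∈S₁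
      backwards : Rooted u (U ∪ V) S → Rooted u U S ⊎ Glued S
      backwards (sub@(_ , c) , S⊆ , u∈S) with nonempty? (S ∩ V)
      ... | no empty = inj₁ (sub , ⊆-part u∈U v∈V disj uv only S⊆ (λ x∈S x∈V → empty (_ , x∈p∩q⁺ (x∈S , x∈V))) , u∈S)
      ... | yes (y , y∈) with x∈p∩q⁻ S V y∈
      ...   | y∈S , y∈V with crossing u∈U v∈V disj uv only S⊆ (c u y u∈S y∈S) u∈U y∈V
      ...     | _ , v∈S = inj₂ (S ∩ U , S ∩ V ,
                 (((u , u∈) , restrict-connected u∈U v∈V disj uv only S⊆ c) , p∩q⊆q S U , u∈) ,
                 (((v , v∈) , restrict-connected v∈V u∈U disjᵒ uvᵒ onlyᵒ (swap-⊆ U V S⊆) c) , p∩q⊆q S V , v∈) ,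
                 ∩-cover U V S⊆)
        where
        u∈ : u ∈ S ∩ U
        u∈ = x∈p∩q⁺ (u∈S , u∈U)
        v∈ : v ∈ S ∩ V
        v∈ = x∈p∩q⁺ (v∈S , v∈V)

    -- A connected set meeting both sides contains `u` by `crossing`. One that avoids `u` and meets
    -- `V` is therefore contained in `V`.
    inner-join : ∀ S → (Inner u U S ⊎ (Inner v V S ⊎ Rooted v V S)) ⇔ Inner u (U ∪ V) S
    inner-join S = mk⇔ forwards backwards
      where
      forwards : Inner u U S ⊎ (Inner v V S ⊎ Rooted v V S) → Inner u (U ∪ V) S
      forwards (inj₁ (sub , S⊆U , u∉S))        = sub , ⊆-∪ˡ U V S⊆U , u∉S
      forwards (inj₂ (inj₁ (sub , S⊆V , _))) = sub , ⊆-∪ʳ U V S⊆V , λ u∈S → disj u∈U (S⊆V u∈S)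
      forwards (inj₂ (inj₂ (sub , S⊆V , _))) = sub , ⊆-∪ʳ U V S⊆V , λ u∈S → disj u∈U (S⊆V u∈S)
      backwards : Inner u (U ∪ V) S → Inner u U S ⊎ (Inner v V S ⊎ Rooted v V S)
      backwards (sub@(_ , c) , S⊆ , u∉S) with nonempty? (S ∩ V)
      ... | no empty = inj₁ (sub , ⊆-part u∈U v∈V disj uv only S⊆ (λ x∈S x∈V → empty (_ , x∈p∩q⁺ (x∈S , x∈V))) , u∉S)
      ... | yes (y , y∈) with x∈p∩q⁻ S V y∈
      ...   | y∈S , y∈V = inj₂ side
        where
        S⊆V : S ⊆ V
        S⊆V = ⊆-part v∈V u∈U disjᵒ uvᵒ onlyᵒ (swap-⊆ U V S⊆)
                λ x∈S x∈U → u∉S (proj₁ (crossing u∈U v∈V disj uv only S⊆ (c _ y x∈S y∈S) x∈U y∈V))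
        side : Inner v V S ⊎ Rooted v V S
        side with v ∈? S
        ... | yes v∈S = inj₂ (sub , S⊆V , v∈S)
        ... | no v∉S  = inj₁ (sub , S⊆V , v∉S)

  enumerate-singleton : ∀ r → Enumeration (Rooted r ⁅ r ⁆) 1 1
  enumerate-singleton r = record
    { list     = ⁅ r ⁆ ∷ []
    ; unique   = [] ∷ []
    ; complete = λ S → mk⇔ forwards backwards
    ; length≡  = refl
    ; sum≡     = trans (+-identityʳ (size ⁅ r ⁆)) (∣⁅x⁆∣≡1 r)
    }
    where
    forwards : ∀ {S} → S LM.∈ ⁅ r ⁆ ∷ [] → Rooted r ⁅ r ⁆ S
    forwards (here refl) = ((r , x∈⁅x⁆ r) , singleton-connected r) , ⊆-refl , x∈⁅x⁆ r
    backwards : ∀ {S} → Rooted r ⁅ r ⁆ S → S LM.∈ ⁅ r ⁆ ∷ []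
    backwards {S} (_ , S⊆ , r∈S) = here (⊆-antisym S⊆ λ x∈ → subst (_∈ S) (sym (x∈⁅y⁆⇒x≡y r x∈)) r∈S)

  enumerate-singleton-inner : ∀ r → Enumeration (Inner r ⁅ r ⁆) 0 0
  enumerate-singleton-inner r = record
    { list     = []
    ; unique   = []
    ; complete = λ S → mk⇔ (λ ()) backwards
    ; length≡  = refl
    ; sum≡     = refl
    }
    where
    backwards : ∀ {S} → Inner r ⁅ r ⁆ S → S LM.∈ []
    backwards {S} (((x , x∈S) , _) , S⊆ , r∉S) = contradiction (subst (_∈ S) (x∈⁅y⁆⇒x≡y r (S⊆ x∈S)) x∈S) r∉S

  enumerate-rooted : ∀ {r U t} → Decomposition G r U t → Enumeration (Rooted r U) (rooted t) (rootedSum t)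
  enumerate-rooted (single r) = enumerate-singleton r
  enumerate-rooted (join {u} {v} {U} {V} {s} {t} d e disj uv only) =
    -- Only the count is rewritten: `rootedSum` is defined in exactly the shape that `enum-⊎` and
    -- `enum-∪` produce.
    subst (λ a → Enumeration (Rooted u (U ∪ V)) a (rootedSum (s ◁ t))) (sym (*-suc (rooted s) (rooted t)))
      (enum-⇔ (rooted-join (root∈ d) (root∈ e) disj uv only)
        (enum-⊎ apart (enumerate-rooted d)
          (enum-∪ disj (λ _ → proj₁ ∘ proj₂) (λ _ → proj₁ ∘ proj₂) (enumerate-rooted d) (enumerate-rooted e))))
    where
    apart : ∀ S → Rooted u U S → Glued (root∈ d) (root∈ e) disj uv only S → ⊥
    apart _ (_ , S⊆U , _) (S₁ , S₂ , _ , (_ , S₂⊆V , v∈S₂) , refl) = disj (S⊆U (q⊆p∪q S₁ S₂ v∈S₂)) (S₂⊆V v∈S₂)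

  enumerate-inner : ∀ {r U t} → Decomposition G r U t → Enumeration (Inner r U) (inner t) (innerSum t)
  enumerate-inner (single r) = enumerate-singleton-inner r
  enumerate-inner (join {u} {v} {U} {V} {s} {t} d e disj uv only) =
    enum-⇔ (inner-join (root∈ d) (root∈ e) disj uv only)
      (enum-⊎ apart (enumerate-inner d)
        (enum-⊎ (λ { _ (_ , _ , v∉S) (_ , _ , v∈S) → v∉S v∈S }) (enumerate-inner e) (enumerate-rooted e)))
    where
    apart : ∀ S → Inner u U S → Inner v V S ⊎ Rooted v V S → ⊥
    apart _ ((ne , _) , S⊆U , _) (inj₁ (_ , S⊆V , _)) = nonempty-apart disj ne S⊆U S⊆V
    apart _ ((ne , _) , S⊆U , _) (inj₂ (_ , S⊆V , _)) = nonempty-apart disj ne S⊆U S⊆V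

  enumerate-subtrees : ∀ {r t} → Decomposition G r (full n) t →
                       Enumeration (IsSubtree G) (rooted t + inner t) (rootedSum t + innerSum t)
  enumerate-subtrees {r} d = enum-⇔ (λ S → mk⇔ forget (classify S))
    (enum-⊎ (λ { _ (_ , _ , r∈S) (_ , _ , r∉S) → r∉S r∈S }) (enumerate-rooted d) (enumerate-inner d))
    where
    forget : ∀ {S} → Rooted r (full n) S ⊎ Inner r (full n) S → IsSubtree G S
    forget (inj₁ (sub , _)) = sub
    forget (inj₂ (sub , _)) = sub
    classify : ∀ S → IsSubtree G S → Rooted r (full n) S ⊎ Inner r (full n) S
    classify S sub with r ∈? S
    ... | yes r∈S = inj₁ (sub , (λ _ → ∈⊤) , r∈S)
    ... | no r∉S  = inj₂ (sub , (λ _ → ∈⊤) , r∉S)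

-- Decomposing a tree

unique-⊆-length : {A : Set} {xs ys : List A} → Unique xs → (∀ {x} → x LM.∈ xs → x LM.∈ ys) → length xs ≤ length ys
unique-⊆-length []             _  = z≤n
unique-⊆-length {xs = x ∷ xs} {ys} (x∉xs ∷ uniq) xs⊆ys with ∈-∃++ (xs⊆ys (here refl))
... | as , bs , refl = begin
  suc (length xs)             ≤⟨ s≤s (unique-⊆-length uniq rest) ⟩
  suc (length (as ++ bs))     ≡⟨ cong suc (length-++ as) ⟩
  suc (length as + length bs) ≡⟨ +-suc (length as) (length bs) ⟨
  length as + suc (length bs) ≡⟨ length-++ as ⟨
  length (as ++ x ∷ bs) ∎
  where
  open ≤-Reasoning
  rest : ∀ {y} → y LM.∈ xs → y LM.∈ as ++ bs
  rest y∈xs with ∈-++⁻ as (xs⊆ys (there y∈xs))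
  ... | inj₁ y∈as         = ∈-++⁺ˡ y∈as
  ... | inj₂ (here refl)  = contradiction refl (All.lookup x∉xs y∈xs)
  ... | inj₂ (there y∈bs) = ∈-++⁺ʳ as y∈bs

length-filter-row : {A : Set} (c : A → A → Bool) (u : A) (vs : List A) →
  length (filter (λ (x , y) → T? (c x y)) (map (u ,_) vs)) ≡ sum (map (λ v → if c u v then 1 else 0) vs)
length-filter-row c u []       = refl
length-filter-row c u (v ∷ vs) with c u v
... | true  = cong suc (length-filter-row c u vs)
... | false = length-filter-row c u vs

length-filter-product : {A : Set} (c : A → A → Bool) (us vs : List A) →
  length (filter (λ (x , y) → T? (c x y)) (cartesianProduct us vs)) ≡
  sum (map (λ u → sum (map (λ v → if c u v then 1 else 0) vs)) us)
length-filter-product c []       vs = refl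
length-filter-product c (u ∷ us) vs = begin
  length (filter P? (map (u ,_) vs ++ cartesianProduct us vs))
    ≡⟨ cong length (filter-++ P? (map (u ,_) vs) (cartesianProduct us vs)) ⟩
  length (filter P? (map (u ,_) vs) ++ filter P? (cartesianProduct us vs))
    ≡⟨ length-++ (filter P? (map (u ,_) vs)) ⟩
  length (filter P? (map (u ,_) vs)) + length (filter P? (cartesianProduct us vs))
    ≡⟨ cong₂ _+_ (length-filter-row c u vs) (length-filter-product c us vs) ⟩
  sum (map (λ v → if c u v then 1 else 0) vs) + sum (map (λ u → sum (map (λ v → if c u v then 1 else 0) vs)) us) ∎
  where
  open ≡-Reasoning
  P? : ∀ p → Dec (T (c (proj₁ p) (proj₂ p)))
  P? (x , y) = T? (c x y)

size-insert : (U : Subset n) (v : Fin n) → v ∉ U → size (U ∪ ⁅ v ⁆) ≡ suc (size U)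
size-insert U v v∉U = trans (size-∪ U ⁅ v ⁆ (λ x∈U x∈v → v∉U (subst (_∈ U) (x∈⁅y⁆⇒x≡y v x∈v) x∈U)))
                            (trans (cong (size U +_) (∣⁅x⁆∣≡1 v)) (+-comm (size U) 1))

module _ {n : ℕ} (G : Graph n) where

  adj-sym : ∀ {u v} → adj G u v ≡ true → adj G v u ≡ true
  adj-sym {u} {v} uv = trans (Graph.sym G v u) uv

  -- The leaf goes into the part that contains its neighbour `u`. The join remains a bridge, since
  -- an edge from `v` to the other part would have to end at `u`, against disjointness.
  insert-leaf : ∀ {r U t u v} → Decomposition G r U t → u ∈ U → v ∉ U → adj G u v ≡ true →
                (∀ {w} → w ∈ U → adj G w v ≡ true → w ≡ u) → ∃[ t′ ] Decomposition G r (U ∪ ⁅ v ⁆) t′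
  insert-leaf {u = u} {v} (single r) u∈ v∉ uv only with x∈⁅y⁆⇒x≡y r u∈
  ... | refl = _ , join (single r) (single v)
      (λ x∈r x∈v → v∉ (subst (_∈ ⁅ r ⁆) (x∈⁅y⁆⇒x≡y v x∈v) x∈r)) uv
      λ x∈ y∈ _ → x∈⁅y⁆⇒x≡y r x∈ , x∈⁅y⁆⇒x≡y v y∈
  insert-leaf {u = u} {v} (join {a} {b} {U} {V} d e disj ab bridge) u∈ v∉ uv only with x∈p∪q⁻ U V u∈
  ... | inj₁ u∈U with insert-leaf d u∈U (v∉ ∘ p⊆p∪q V) uv (only ∘ p⊆p∪q V)
  ...   | _ , d′ = _ , subst (λ W → Decomposition G a W _) rearrange (join d′ e disj′ ab bridge′)
    where
    rearrange : (U ∪ ⁅ v ⁆) ∪ V ≡ (U ∪ V) ∪ ⁅ v ⁆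
    rearrange = trans (∪-assoc U ⁅ v ⁆ V) (trans (cong (U ∪_) (∪-comm ⁅ v ⁆ V)) (sym (∪-assoc U V ⁅ v ⁆)))
    disj′ : Disjoint (U ∪ ⁅ v ⁆) V
    disj′ x∈ x∈V with x∈p∪q⁻ U ⁅ v ⁆ x∈
    ... | inj₁ x∈U = disj x∈U x∈V
    ... | inj₂ x∈v = v∉ (q⊆p∪q U V (subst (_∈ V) (x∈⁅y⁆⇒x≡y v x∈v) x∈V))
    bridge′ : ∀ {x y} → x ∈ U ∪ ⁅ v ⁆ → y ∈ V → adj G x y ≡ true → x ≡ a × y ≡ b
    bridge′ {x} {y} x∈ y∈V xy with x∈p∪q⁻ U ⁅ v ⁆ x∈
    ... | inj₁ x∈U = bridge x∈U y∈V xy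
    ... | inj₂ x∈v with x∈⁅y⁆⇒x≡y v x∈v
    ...   | refl = contradiction (subst (_∈ V) (only (q⊆p∪q U V y∈V) (adj-sym xy)) y∈V) (disj u∈U)
  insert-leaf {u = u} {v} (join {a} {b} {U} {V} d e disj ab bridge) u∈ v∉ uv only
      | inj₂ u∈V with insert-leaf e u∈V (v∉ ∘ q⊆p∪q U V) uv (only ∘ q⊆p∪q U V)
  ...   | _ , e′ = _ , subst (λ W → Decomposition G a W _) (sym (∪-assoc U V ⁅ v ⁆)) (join d e′ disj′ ab bridge′)
    where
    disj′ : Disjoint U (V ∪ ⁅ v ⁆)
    disj′ x∈U x∈ with x∈p∪q⁻ V ⁅ v ⁆ x∈
    ... | inj₁ x∈V = disj x∈U x∈V
    ... | inj₂ x∈v = v∉ (p⊆p∪q V (subst (_∈ U) (x∈⁅y⁆⇒x≡y v x∈v) x∈U))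
    bridge′ : ∀ {x y} → x ∈ U → y ∈ V ∪ ⁅ v ⁆ → adj G x y ≡ true → x ≡ a × y ≡ b
    bridge′ {x} {y} x∈U y∈ xy with x∈p∪q⁻ V ⁅ v ⁆ y∈
    ... | inj₁ y∈V = bridge x∈U y∈V xy
    ... | inj₂ y∈v with x∈⁅y⁆⇒x≡y v y∈v
    ...   | refl = contradiction (subst (_∈ V) (sym (only (p⊆p∪q V x∈U) xy)) u∈V) (disj x∈U)

  EdgeIn : Subset n → Fin n × Fin n → Set
  EdgeIn U (x , y) = adj G x y ≡ true × toℕ x < toℕ y × x ∈ U × y ∈ U

  Edges : Subset n → List (Fin n × Fin n) → Set
  Edges U es = Unique es × All (EdgeIn U) es

  edges-length : ∀ {U es} → Edges U es → length es ≤ edgeCount G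
  edges-length {es = es} (uniq , edges) = ≤-trans (unique-⊆-length uniq listed)
    (≤-reflexive (length-filter-product c (allFin n) (allFin n)))
    where
    c : Fin n → Fin n → Bool
    c u v = adj G u v ∧ (toℕ u <ᵇ toℕ v)
    listed : ∀ {p} → p LM.∈ es → p LM.∈ filter (λ (x , y) → T? (c x y)) (cartesianProduct (allFin n) (allFin n))
    listed {x , y} p∈ with All.lookup edges p∈
    ... | xy , x<y , _ = ∈-filter⁺ (λ (x , y) → T? (c x y)) (∈-cartesianProduct⁺ (∈-allFin x) (∈-allFin y))
                           (subst (λ b → T (b ∧ (toℕ x <ᵇ toℕ y))) (sym xy) (<⇒<ᵇ x<y))

  -- Of the two orientations of an edge, the one that `edgeCount` counts.
  Oriented : Fin n → Fin n → Fin n × Fin n → Set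
  Oriented u v p = (p ≡ (u , v) × toℕ u < toℕ v) ⊎ (p ≡ (v , u) × toℕ v < toℕ u)

  orient : ∀ u v → u ≢ v → ∃[ p ] Oriented u v p
  orient u v u≢v with <-cmp (toℕ u) (toℕ v)
  ... | tri< u<v _ _ = (u , v) , inj₁ (refl , u<v)
  ... | tri≈ _ u≡v _ = contradiction (Fin.toℕ-injective u≡v) u≢v
  ... | tri> _ _ v<u = (v , u) , inj₂ (refl , v<u)

  oriented-edge : ∀ {U u v p} → adj G u v ≡ true → u ∈ U → v ∈ U → Oriented u v p → EdgeIn U p
  oriented-edge uv u∈ v∈ (inj₁ (refl , u<v)) = uv , u<v , u∈ , v∈
  oriented-edge uv u∈ v∈ (inj₂ (refl , v<u)) = adj-sym uv , v<u , v∈ , u∈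

  oriented-fresh : ∀ {U u v p q} → v ∉ U → Oriented u v p → EdgeIn U q → p ≢ q
  oriented-fresh v∉U (inj₁ (refl , _)) (_ , _ , _ , v∈U) refl = v∉U v∈U
  oriented-fresh v∉U (inj₂ (refl , _)) (_ , _ , v∈U , _) refl = v∉U v∈U

  oriented-injective : ∀ {u w v p} → u ≢ v → Oriented u v p → Oriented w v p → u ≡ w
  oriented-injective u≢v (inj₁ (refl , _)) (inj₁ (refl , _)) = refl
  oriented-injective u≢v (inj₁ (refl , _)) (inj₂ (refl , _)) = refl
  oriented-injective u≢v (inj₂ (refl , _)) (inj₁ (refl , _)) = refl
  oriented-injective u≢v (inj₂ (refl , _)) (inj₂ (refl , _)) = refl

  edges-mono : ∀ {U V es} → U ⊆ V → Edges U es → Edges V es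
  edges-mono U⊆V (uniq , edges) = uniq , All.map (λ (xy , x<y , x∈ , y∈) → xy , x<y , U⊆V x∈ , U⊆V y∈) edges

  -- Either U already spans as many edges as it has vertices, or G restricted to U is a tree.
  Status : Fin n → Subset n → Set
  Status r U = ∃[ es ] Edges U es ×
    (size U ≤ length es ⊎ (size U ≡ suc (length es) × ∃[ t ] Decomposition G r U t))

  -- The new vertex always brings the edge to `u`. If that is its only edge into `U`, it is a leaf
  -- of the decomposition; a second neighbour `w` brings a second edge, and the edges catch up with
  -- the vertices.
  status-insert : ∀ {r U u v} → u ∈ U → v ∉ U → adj G u v ≡ true → Status r U → Status r (U ∪ ⁅ v ⁆)
  status-insert {r} {U} {u} {v} u∈U v∉U uv (es , edges@(uniq , inU) , status) = extend status
    where
    u≢v : u ≢ v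
    u≢v refl = v∉U u∈U
    W : Subset n
    W = U ∪ ⁅ v ⁆
    U⊆W : U ⊆ W
    U⊆W = p⊆p∪q ⁅ v ⁆
    v∈W : v ∈ W
    v∈W = q⊆p∪q U ⁅ v ⁆ (x∈⁅x⁆ v)
    p : Fin n × Fin n
    p = proj₁ (orient u v u≢v)
    p-oriented : Oriented u v p
    p-oriented = proj₂ (orient u v u≢v)
    edges⁺ : Edges W (p ∷ es)
    edges⁺ = All.map (oriented-fresh v∉U p-oriented) inU ∷ uniq ,
             oriented-edge uv (U⊆W u∈U) v∈W p-oriented ∷ proj₂ (edges-mono U⊆W edges)
    size-W : size W ≡ suc (size U)
    size-W = size-insert U v v∉U
    extend : size U ≤ length es ⊎ (size U ≡ suc (length es) × ∃[ t ] Decomposition G r U t) → Status r W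
    extend (inj₁ many) = p ∷ es , edges⁺ , inj₁ (subst (_≤ suc (length es)) (sym size-W) (s≤s many))
    extend (inj₂ (size≡ , t , d)) with Fin.any? (λ w → (w ∈? U) ×-dec (adj G w v Bool.≟ true) ×-dec ¬? (w Fin.≟ u))
    ... | no none = p ∷ es , edges⁺ , inj₂ (trans size-W (cong suc size≡) , insert-leaf d u∈U v∉U uv only)
      where
      only : ∀ {w} → w ∈ U → adj G w v ≡ true → w ≡ u
      only {w} w∈U wv with w Fin.≟ u
      ... | yes w≡u = w≡u
      ... | no w≢u  = contradiction (w , w∈U , wv , w≢u) none
    ... | yes (w , w∈U , wv , w≢u) = q ∷ p ∷ es ,
          ((q≢p ∷ All.map (oriented-fresh v∉U q-oriented) inU) ∷ proj₁ edges⁺ ,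
           oriented-edge wv (U⊆W w∈U) v∈W q-oriented ∷ proj₂ edges⁺) ,
          inj₁ (≤-reflexive (trans size-W (cong suc size≡)))
      where
      w≢v : w ≢ v
      w≢v refl = v∉U w∈U
      q : Fin n × Fin n
      q = proj₁ (orient w v w≢v)
      q-oriented : Oriented w v q
      q-oriented = proj₂ (orient w v w≢v)
      q≢p : q ≢ p
      q≢p q≡p = w≢u (oriented-injective w≢v q-oriented (subst (Oriented u v) (sym q≡p) p-oriented))

  exit-edge : ∀ {S x y} U → Walk G S x y → x ∈ U → y ∉ U → ∃[ u ] ∃[ v ] u ∈ U × v ∉ U × adj G u v ≡ true
  exit-edge U (stay _) x∈U x∉U = contradiction x∈U x∉U
  exit-edge U (step {u} {w} _ uw walk) u∈U y∉U with w ∈? U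
  ... | yes w∈U = exit-edge U walk w∈U y∉U
  ... | no w∉U  = u , w , u∈U , w∉U , uw

  grow : ∀ r m U → m + size U ≡ n → InducedConnected G (full n) → r ∈ U → Status r U → Status r (full n)
  grow r m U eq conn r∈U status with nonempty? (∁ U)
  ... | no empty = subst (Status r) (⊆-antisym ⊆⊤ λ {x} _ → x∉∁p⇒x∈p λ x∈∁ → empty (x , x∈∁)) status
  grow r zero    U eq conn r∈U status | yes (y , y∈∁U) =
    contradiction (subst (y ∈_) (sym (∣p∣≡n⇒p≡⊤ eq)) ∈⊤) (x∈∁p⇒x∉p y∈∁U)
  grow r (suc m) U eq conn r∈U status | yes (y , y∈∁U) with exit-edge U (conn r y ∈⊤ ∈⊤) r∈U (x∈∁p⇒x∉p y∈∁U)
  ... | u , v , u∈U , v∉U , uv = grow r m (U ∪ ⁅ v ⁆)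
          (trans (cong (m +_) (size-insert U v v∉U)) (trans (+-suc m (size U)) eq))
          conn (p⊆p∪q ⁅ v ⁆ r∈U) (status-insert u∈U v∉U uv status)

  -- Growing from `r` along edges that leave the current set reaches all vertices. There the first
  -- alternative of `Status` would give at least `n` edges instead of `n ∸ 1`; the vertex `r`
  -- ensures `1 ≤ n`, so the subtraction is not truncated.
  tree-decomposition : (r : Fin n) → IsTree G → ∃[ t ] Decomposition G r (full n) t
  tree-decomposition r (conn , edges≡) = finish (grow r (n ∸ 1) ⁅ r ⁆ size≡ conn (x∈⁅x⁆ r)
      ([] , ([] , []) , inj₂ (∣⁅x⁆∣≡1 r , ∙ , single r)))
    where
    1≤n : 1 ≤ n
    1≤n = ≤-trans (s≤s z≤n) (Fin.toℕ<n r)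
    size≡ : n ∸ 1 + size ⁅ r ⁆ ≡ n
    size≡ = trans (cong (n ∸ 1 +_) (∣⁅x⁆∣≡1 r)) (m∸n+n≡m 1≤n)
    finish : Status r (full n) → ∃[ t ] Decomposition G r (full n) t
    finish (_ , _ , inj₂ (_ , d)) = d
    finish (es , edges , inj₁ many) = contradiction
      (≤-trans (subst (_≤ length es) (∣⊤∣≡n n) many) (≤-trans (edges-length edges) (≤-reflexive edges≡)))
      (<⇒≱ (∸-monoʳ-< {n} {1} {0} (s≤s z≤n) 1≤n))

-- Realising caterpillars as graphs

sum-allFin-suc : (g : Fin (suc n) → ℕ) → sum (map g (allFin (suc n))) ≡ g zero + sum (map (g ∘ suc) (allFin n))
sum-allFin-suc g = cong (λ xs → g zero + sum xs) (trans (map-tabulate suc g) (sym (map-tabulate id (g ∘ suc))))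

sum-allFin-0 : ∀ n → sum (map (λ _ → 0) (allFin n)) ≡ 0
sum-allFin-0 zero    = refl
sum-allFin-0 (suc n) = trans (sum-allFin-suc {n} (λ _ → 0)) (sum-allFin-0 n)

-- This is the row of the new vertex in `pendant`, with `∧ true` left over from the comparison of 0
-- with a successor.
indicator : Fin n → Fin n → ℕ
indicator r v = if does (v Fin.≟ r) ∧ true then 1 else 0

sum-indicator : (r : Fin n) → sum (map (indicator r) (allFin n)) ≡ 1
sum-indicator {suc n} zero    = trans (sum-allFin-suc (indicator {suc n} zero)) (cong suc (sum-allFin-0 n))
sum-indicator {suc n} (suc r) = trans (sum-allFin-suc (indicator (suc r))) (sum-indicator r)

module _ {n : ℕ} (G : Graph n) (r : Fin n) where

  pendant-adj : Fin (suc n) → Fin (suc n) → Bool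
  pendant-adj zero    zero    = false
  pendant-adj zero    (suc v) = does (v Fin.≟ r)
  pendant-adj (suc u) zero    = does (u Fin.≟ r)
  pendant-adj (suc u) (suc v) = adj G u v

  pendant : Graph (suc n)
  pendant = record { adj = pendant-adj ; sym = symmetric ; irrefl = irreflexive }
    where
    symmetric : ∀ u v → pendant-adj u v ≡ pendant-adj v u
    symmetric zero    zero    = refl
    symmetric zero    (suc v) = refl
    symmetric (suc u) zero    = refl
    symmetric (suc u) (suc v) = Graph.sym G u v
    irreflexive : ∀ v → pendant-adj v v ≡ false
    irreflexive zero    = refl
    irreflexive (suc v) = Graph.irrefl G v

  -- The new vertex is `zero`, so its edge is counted in row `zero` alone: in every other row the
  -- comparison with column `zero` fails.
  pendant-edgeCount : edgeCount pendant ≡ suc (edgeCount G)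
  pendant-edgeCount = begin
    edgeCount pendant
      ≡⟨ sum-allFin-suc row ⟩
    row zero + sum (map (row ∘ suc) (allFin n))
      ≡⟨ cong₂ _+_ (trans (sum-allFin-suc (entry zero)) (sum-indicator r)) (cong sum (map-cong row-suc (allFin n))) ⟩
    suc (edgeCount G) ∎
    where
    open ≡-Reasoning
    entry : Fin (suc n) → Fin (suc n) → ℕ
    entry u v = if pendant-adj u v ∧ (toℕ u <ᵇ toℕ v) then 1 else 0
    row : Fin (suc n) → ℕ
    row u = sum (map (entry u) (allFin (suc n)))
    row-suc : ∀ u → row (suc u) ≡ sum (map (λ v → if adj G u v ∧ (toℕ u <ᵇ toℕ v) then 1 else 0) (allFin n))
    row-suc u = trans (sum-allFin-suc (entry (suc u)))
      (cong (λ b → (if b then 1 else 0) + sum (map (entry (suc u) ∘ suc) (allFin n))) (∧-zeroʳ (does (u Fin.≟ r))))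

  lift-decomposition : ∀ {q U t} → Decomposition G q U t → Decomposition pendant (suc q) (outside ∷ U) t
  lift-decomposition (single q) = single (suc q)
  lift-decomposition (join {u} {v} {U} {V} d e disj uv only) =
    join (lift-decomposition d) (lift-decomposition e) (λ { (there x∈U) (there x∈V) → disj x∈U x∈V }) uv only′′
    where
    only′′ : ∀ {x y} → x ∈ outside ∷ U → y ∈ outside ∷ V → pendant-adj x y ≡ true → x ≡ suc u × y ≡ suc v
    only′′ (there x∈U) (there y∈V) xy with only x∈U y∈V xy
    ... | refl , refl = refl , refl

  root-adjacent : does (r Fin.≟ r) ≡ true
  root-adjacent with r Fin.≟ r
  ... | yes _  = refl
  ... | no r≢r = contradiction refl r≢r

  adjacent-root : ∀ {v} → does (v Fin.≟ r) ≡ true → v ≡ r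
  adjacent-root {v} eq with v Fin.≟ r
  adjacent-root eq | yes v≡r = v≡r

  add-leaf : ∀ {t} → Decomposition G r (full n) t → Decomposition pendant (suc r) (full (suc n)) (t ◁ ∙)
  add-leaf {t} d = subst (λ U → Decomposition pendant (suc r) (inside ∷ U) (t ◁ ∙)) (∪-identityʳ ⊤)
    (join (lift-decomposition d) (single zero) (λ { (there _) (there x∈⊥) → ∉⊥ x∈⊥ }) root-adjacent only)
    where
    only : ∀ {x y} → x ∈ outside ∷ ⊤ → y ∈ ⁅ zero ⁆ → pendant-adj x y ≡ true → x ≡ suc r × y ≡ zero
    only (there _) here        xy = cong suc (adjacent-root xy) , refl
    only (there _) (there y∈⊥) xy = contradiction y∈⊥ ∉⊥

  add-root : ∀ {t} → Decomposition G r (full n) t → Decomposition pendant zero (full (suc n)) (∙ ◁ t)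
  add-root {t} d = subst (λ U → Decomposition pendant zero (inside ∷ U) (∙ ◁ t)) (∪-identityˡ ⊤)
    (join (single zero) (lift-decomposition d) (λ { (there x∈⊥) (there _) → ∉⊥ x∈⊥ }) root-adjacent only)
    where
    only : ∀ {x y} → x ∈ ⁅ zero ⁆ → y ∈ outside ∷ ⊤ → pendant-adj x y ≡ true → x ≡ zero × y ≡ suc r
    only here        (there _) xy = refl , cong suc (adjacent-root xy)
    only (there x∈⊥) (there _) xy = contradiction x∈⊥ ∉⊥

Realised : RTree → ℕ → Set
Realised t m = Σ[ G ∈ Graph (suc m) ] ∃[ r ] Decomposition G r (full (suc m)) t × edgeCount G ≡ m

-- The number of vertices is existential because `order t + 1` does not compute to a successor.
-- `caterpillar-tree` identifies it with `order t` through `size-decomposition`.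
realise : ∀ {t} → Caterpillar t → ∃[ m ] Realised t m
realise vertex = 0 , record { adj = λ _ _ → false ; sym = λ _ _ → refl ; irrefl = λ _ → refl } , zero , single zero , refl
realise (leaf c) with realise c
... | m , G , r , d , edges = suc m , pendant G r , suc r , add-leaf G r d , trans (pendant-edgeCount G r) (cong suc edges)
realise (above c) with realise c
... | m , G , r , d , edges = suc m , pendant G r , zero , add-root G r d , trans (pendant-edgeCount G r) (cong suc edges)

caterpillar-tree : ∀ {t n} → Caterpillar t → order t ≡ n →
                   Σ[ G ∈ Graph n ] IsTree G × ∃[ r ] Decomposition G r (full n) t
caterpillar-tree c eq with realise c
... | m , G , r , d , edges with trans (sym eq) (trans (sym (size-decomposition d)) (∣⊤∣≡n (suc m)))
...   | refl = G , (decomposition-connected d , edges) , r , d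

-- Rational means

2^⌊log₂n⌋≤n : ∀ n → 1 ≤ n → 2 ^ ⌊log₂ n ⌋ ≤ n
2^⌊log₂n⌋≤n = <-rec _ go
  where
  open ≤-Reasoning
  go : ∀ n → (∀ {m} → m < n → 1 ≤ m → 2 ^ ⌊log₂ m ⌋ ≤ m) → 1 ≤ n → 2 ^ ⌊log₂ n ⌋ ≤ n
  go 1             _  _ = ≤-refl
  go n@(suc (suc k)) ih _ = begin
    -- For `n` at least 2 the logarithm computes to a successor, so this step is definitional.
    2 ^ ⌊log₂ n ⌋             ≡⟨⟩
    2 * 2 ^ (⌊log₂ n ⌋ ∸ 1)   ≡⟨ cong (λ l → 2 * 2 ^ l) (⌊log₂⌊n/2⌋⌋≡⌊log₂n⌋∸1 n) ⟨
    2 * 2 ^ ⌊log₂ ⌊ n /2⌋ ⌋   ≤⟨ *-monoʳ-≤ 2 (ih (⌊n/2⌋<n (suc k)) (s≤s z≤n)) ⟩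
    2 * ⌊ n /2⌋               ≤⟨ 2⌊n/2⌋≤n n ⟩
    n ∎

n<2^[1+⌊log₂n⌋] : ∀ n → n < 2 ^ suc ⌊log₂ n ⌋
n<2^[1+⌊log₂n⌋] n = ≰⇒> λ h →
  <-irrefl refl (subst (_≤ ⌊log₂ n ⌋) (⌊log₂[2^n]⌋≡n (suc ⌊log₂ n ⌋)) (⌊log₂⌋-mono-≤ h))

toℚᵘ-ℕ : ∀ k → toℚᵘ (ℕ→ℚ k) ℚᵘ.≃ mkℚᵘ (ℤ.+ k) 0
toℚᵘ-ℕ k = ℚ.toℚᵘ-fromℚᵘ (mkℚᵘ (ℤ.+ k) 0)

ℕ→ℚ-+ : ∀ m n → ℕ→ℚ (m + n) ≡ ℕ→ℚ m ℚ.+ ℕ→ℚ n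
ℕ→ℚ-+ m n = ℚ.toℚᵘ-injective (begin
  toℚᵘ (ℕ→ℚ (m + n))                  ≈⟨ toℚᵘ-ℕ (m + n) ⟩
  mkℚᵘ (ℤ.+ (m + n)) 0                  ≈⟨ *≡* (cong (ℤ._* ℤ.+ 1) (cong₂ ℤ._+_ (sym (ℤ.*-identityʳ (ℤ.+ m))) (sym (ℤ.*-identityʳ (ℤ.+ n))))) ⟩
  mkℚᵘ (ℤ.+ m) 0 ℚᵘ.+ mkℚᵘ (ℤ.+ n) 0      ≈⟨ ℚᵘ.+-cong (toℚᵘ-ℕ m) (toℚᵘ-ℕ n) ⟨
  toℚᵘ (ℕ→ℚ m) ℚᵘ.+ toℚᵘ (ℕ→ℚ n)      ≈⟨ ℚ.toℚᵘ-homo-+ (ℕ→ℚ m) (ℕ→ℚ n) ⟨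
  toℚᵘ (ℕ→ℚ m ℚ.+ ℕ→ℚ n) ∎)
  where open import Relation.Binary.Reasoning.Setoid ℚᵘ.≃-setoid

ℕ→ℚ-* : ∀ m n → ℕ→ℚ (m * n) ≡ ℕ→ℚ m ℚ.* ℕ→ℚ n
ℕ→ℚ-* m n = ℚ.toℚᵘ-injective (begin
  toℚᵘ (ℕ→ℚ (m * n))                  ≈⟨ toℚᵘ-ℕ (m * n) ⟩
  mkℚᵘ (ℤ.+ (m * n)) 0                  ≈⟨ *≡* (cong (ℤ._* ℤ.+ 1) (ℤ.pos-* m n)) ⟩
  mkℚᵘ (ℤ.+ m) 0 ℚᵘ.* mkℚᵘ (ℤ.+ n) 0      ≈⟨ ℚᵘ.*-cong (toℚᵘ-ℕ m) (toℚᵘ-ℕ n) ⟨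
  toℚᵘ (ℕ→ℚ m) ℚᵘ.* toℚᵘ (ℕ→ℚ n)      ≈⟨ ℚ.toℚᵘ-homo-* (ℕ→ℚ m) (ℕ→ℚ n) ⟨
  toℚᵘ (ℕ→ℚ m ℚ.* ℕ→ℚ n) ∎)
  where open import Relation.Binary.Reasoning.Setoid ℚᵘ.≃-setoid

ℕ→ℚ-mono : ∀ {m n} → m ≤ n → ℕ→ℚ m ℚ.≤ ℕ→ℚ n
ℕ→ℚ-mono {m} {n} m≤n = ℚ.toℚᵘ-cancel-≤ (begin
  toℚᵘ (ℕ→ℚ m)   ≃⟨ toℚᵘ-ℕ m ⟩
  mkℚᵘ (ℤ.+ m) 0   ≤⟨ *≤* (ℤ.*-monoʳ-≤-nonNeg (ℤ.+ 1) (ℤ.+≤+ m≤n)) ⟩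
  mkℚᵘ (ℤ.+ n) 0   ≃⟨ toℚᵘ-ℕ n ⟨
  toℚᵘ (ℕ→ℚ n) ∎)
  where open ℚᵘ.≤-Reasoning

/-*-cancel : ∀ S N .{{_ : NonZero N}} → (ℤ.+ S ℚ./ N) ℚ.* ℕ→ℚ N ≡ ℕ→ℚ S
/-*-cancel S N@(suc k) = ℚ.toℚᵘ-injective (begin
  toℚᵘ ((ℤ.+ S ℚ./ N) ℚ.* ℕ→ℚ N)        ≈⟨ ℚ.toℚᵘ-homo-* (ℤ.+ S ℚ./ N) (ℕ→ℚ N) ⟩
  toℚᵘ (ℤ.+ S ℚ./ N) ℚᵘ.* toℚᵘ (ℕ→ℚ N)  ≈⟨ ℚᵘ.*-cong (ℚ.toℚᵘ-fromℚᵘ (mkℚᵘ (ℤ.+ S) k)) (toℚᵘ-ℕ N) ⟩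
  mkℚᵘ (ℤ.+ S) k ℚᵘ.* mkℚᵘ (ℤ.+ N) 0      ≈⟨ *≡* (trans (ℤ.*-identityʳ (ℤ.+ S ℤ.* ℤ.+ N)) (cong (λ j → ℤ.+ S ℤ.* ℤ.+ j) (sym (*-identityʳ N)))) ⟩
  mkℚᵘ (ℤ.+ S) 0                        ≈⟨ toℚᵘ-ℕ S ⟨
  toℚᵘ (ℕ→ℚ S) ∎)
  where open import Relation.Binary.Reasoning.Setoid ℚᵘ.≃-setoid

ℕ→ℚ-positive : ∀ N → 1 ≤ N → ℚ.Positive (ℕ→ℚ N)
ℕ→ℚ-positive (suc k) _ = ℚ.normalize-pos (suc k) 1

-- The negative term is moved across before multiplying by `N`, so the hypothesis is an inequality
-- in ℕ without subtraction.
mean-≤ : ∀ {μ} N S n k c → 1 ≤ N → μ ℚ.* ℕ→ℚ N ≡ ℕ→ℚ S → S + k * N ≤ (n + c) * N →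
         μ ℚ.≤ ℕ→ℚ n ℚ.- ℕ→ℚ k ℚ.+ ℕ→ℚ c
mean-≤ {μ} N S n k c 1≤N eq h = begin
  μ                                           ≡⟨ ℚ.+-identityʳ μ ⟨
  μ ℚ.+ ℚ.0ℚ                                  ≡⟨ cong (μ ℚ.+_) (ℚ.+-inverseʳ (ℕ→ℚ k)) ⟨
  μ ℚ.+ (ℕ→ℚ k ℚ.- ℕ→ℚ k)                     ≡⟨ ℚ.+-assoc μ (ℕ→ℚ k) (ℚ.- ℕ→ℚ k) ⟨
  μ ℚ.+ ℕ→ℚ k ℚ.- ℕ→ℚ k                       ≤⟨ ℚ.+-monoˡ-≤ (ℚ.- ℕ→ℚ k) cleared ⟩
  ℕ→ℚ n ℚ.+ ℕ→ℚ c ℚ.- ℕ→ℚ k                   ≡⟨ ℚ.+-assoc (ℕ→ℚ n) (ℕ→ℚ c) (ℚ.- ℕ→ℚ k) ⟩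
  ℕ→ℚ n ℚ.+ (ℕ→ℚ c ℚ.- ℕ→ℚ k)                 ≡⟨ cong (ℕ→ℚ n ℚ.+_) (ℚ.+-comm (ℕ→ℚ c) (ℚ.- ℕ→ℚ k)) ⟩
  ℕ→ℚ n ℚ.+ (ℚ.- ℕ→ℚ k ℚ.+ ℕ→ℚ c)             ≡⟨ ℚ.+-assoc (ℕ→ℚ n) (ℚ.- ℕ→ℚ k) (ℕ→ℚ c) ⟨
  ℕ→ℚ n ℚ.- ℕ→ℚ k ℚ.+ ℕ→ℚ c ∎
  where
  open ℚ.≤-Reasoning
  cleared : μ ℚ.+ ℕ→ℚ k ℚ.≤ ℕ→ℚ n ℚ.+ ℕ→ℚ c
  cleared = ℚ.*-cancelʳ-≤-pos (ℕ→ℚ N) {{ℕ→ℚ-positive N 1≤N}} (begin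
    (μ ℚ.+ ℕ→ℚ k) ℚ.* ℕ→ℚ N                   ≡⟨ ℚ.*-distribʳ-+ (ℕ→ℚ N) μ (ℕ→ℚ k) ⟩
    μ ℚ.* ℕ→ℚ N ℚ.+ ℕ→ℚ k ℚ.* ℕ→ℚ N           ≡⟨ cong₂ ℚ._+_ eq (sym (ℕ→ℚ-* k N)) ⟩
    ℕ→ℚ S ℚ.+ ℕ→ℚ (k * N)                     ≡⟨ ℕ→ℚ-+ S (k * N) ⟨
    ℕ→ℚ (S + k * N)                           ≤⟨ ℕ→ℚ-mono h ⟩
    ℕ→ℚ ((n + c) * N)                         ≡⟨ ℕ→ℚ-* (n + c) N ⟩
    ℕ→ℚ (n + c) ℚ.* ℕ→ℚ N                     ≡⟨ cong (ℚ._* ℕ→ℚ N) (ℕ→ℚ-+ n c) ⟩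
    (ℕ→ℚ n ℚ.+ ℕ→ℚ c) ℚ.* ℕ→ℚ N ∎)

≤-mean : ∀ {μ} N S n k c → 1 ≤ N → μ ℚ.* ℕ→ℚ N ≡ ℕ→ℚ S → n * N ≤ S + (k + c) * N →
         ℕ→ℚ n ℚ.- ℕ→ℚ k ℚ.- ℕ→ℚ c ℚ.≤ μ
≤-mean {μ} N S n k c 1≤N eq h = begin
  ℕ→ℚ n ℚ.- ℕ→ℚ k ℚ.- ℕ→ℚ c                   ≡⟨ ℚ.+-assoc (ℕ→ℚ n) (ℚ.- ℕ→ℚ k) (ℚ.- ℕ→ℚ c) ⟩
  ℕ→ℚ n ℚ.+ (ℚ.- ℕ→ℚ k ℚ.- ℕ→ℚ c)             ≡⟨ cong (ℕ→ℚ n ℚ.+_) (ℚ.neg-distrib-+ (ℕ→ℚ k) (ℕ→ℚ c)) ⟨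
  ℕ→ℚ n ℚ.- (ℕ→ℚ k ℚ.+ ℕ→ℚ c)                 ≡⟨ cong (λ q → ℕ→ℚ n ℚ.- q) (ℕ→ℚ-+ k c) ⟨
  ℕ→ℚ n ℚ.- ℕ→ℚ (k + c)                       ≤⟨ ℚ.+-monoˡ-≤ (ℚ.- ℕ→ℚ (k + c)) cleared ⟩
  μ ℚ.+ ℕ→ℚ (k + c) ℚ.- ℕ→ℚ (k + c)           ≡⟨ ℚ.+-assoc μ (ℕ→ℚ (k + c)) (ℚ.- ℕ→ℚ (k + c)) ⟩
  μ ℚ.+ (ℕ→ℚ (k + c) ℚ.- ℕ→ℚ (k + c))         ≡⟨ cong (μ ℚ.+_) (ℚ.+-inverseʳ (ℕ→ℚ (k + c))) ⟩
  μ ℚ.+ ℚ.0ℚ                                  ≡⟨ ℚ.+-identityʳ μ ⟩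
  μ ∎
  where
  open ℚ.≤-Reasoning
  cleared : ℕ→ℚ n ℚ.≤ μ ℚ.+ ℕ→ℚ (k + c)
  cleared = ℚ.*-cancelʳ-≤-pos (ℕ→ℚ N) {{ℕ→ℚ-positive N 1≤N}} (begin
    ℕ→ℚ n ℚ.* ℕ→ℚ N                           ≡⟨ ℕ→ℚ-* n N ⟨
    ℕ→ℚ (n * N)                               ≤⟨ ℕ→ℚ-mono h ⟩
    ℕ→ℚ (S + (k + c) * N)                     ≡⟨ ℕ→ℚ-+ S ((k + c) * N) ⟩
    ℕ→ℚ S ℚ.+ ℕ→ℚ ((k + c) * N)               ≡⟨ cong₂ ℚ._+_ (sym eq) (ℕ→ℚ-* (k + c) N) ⟩
    μ ℚ.* ℕ→ℚ N ℚ.+ ℕ→ℚ (k + c) ℚ.* ℕ→ℚ N     ≡⟨ ℚ.*-distribʳ-+ (ℕ→ℚ N) μ (ℕ→ℚ (k + c)) ⟨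
    (μ ℚ.+ ℕ→ℚ (k + c)) ℚ.* ℕ→ℚ N ∎)

total>0 : ∀ t → 1 ≤ proj₁ (total t)
total>0 t = ≤-trans (rooted>0 t) (m≤m+n (rooted t) (inner t))

mean-subtree-order : ∀ {n} {G : Graph n} {μ N S} → Enumeration (IsSubtree G) N S → MeanSubtreeOrder G μ →
                     μ ℚ.* ℕ→ℚ N ≡ ℕ→ℚ S
mean-subtree-order {μ = μ} e (L , uniq , complete , eq) =
  subst₂ (λ N S → μ ℚ.* ℕ→ℚ N ≡ ℕ→ℚ S) (proj₁ counts≡) (proj₂ counts≡) eq
  where
  counts≡ : length L ≡ _ × sum (map size L) ≡ _
  counts≡ = enum-unique (record { list = L ; unique = uniq ; complete = complete ; length≡ = refl ; sum≡ = refl }) e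

module _ {n : ℕ} {G : Graph n} {r t} (d : Decomposition G r (full n) t) where

  order≡ : order t ≡ n
  order≡ = trans (sym (size-decomposition d)) (∣⊤∣≡n n)

  mean-upper : ∀ {μ} k c → proj₂ (total t) + k * proj₁ (total t) ≤ (n + c) * proj₁ (total t) → MeanSubtreeOrder G μ →
               μ ℚ.≤ ℕ→ℚ n ℚ.- ℕ→ℚ k ℚ.+ ℕ→ℚ c
  mean-upper {μ} k c h mean =
    mean-≤ (proj₁ (total t)) (proj₂ (total t)) n k c (total>0 t) (mean-subtree-order {μ = μ} (enumerate-subtrees d) mean) h

  mean-lower : ∀ k c → n * proj₁ (total t) ≤ proj₂ (total t) + (k + c) * proj₁ (total t) →
               ∃[ μ ] MeanSubtreeOrder G μ × ℕ→ℚ n ℚ.- ℕ→ℚ k ℚ.- ℕ→ℚ c ℚ.≤ μ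
  mean-lower k c h = μ ,
    (list e , unique e , complete e , subst₂ (λ N S → μ ℚ.* ℕ→ℚ N ≡ ℕ→ℚ S) (sym (length≡ e)) (sym (sum≡ e)) eq) ,
    ≤-mean (proj₁ (total t)) (proj₂ (total t)) n k c (total>0 t) eq h
    where
    open Enumeration
    instance
      total≢0 : NonZero (proj₁ (total t))
      total≢0 = >-nonZero (total>0 t)
    e : Enumeration (IsSubtree G) (proj₁ (total t)) (proj₂ (total t))
    e = enumerate-subtrees d
    μ : ℚ
    μ = ℤ.+ proj₂ (total t) ℚ./ proj₁ (total t)
    eq : μ ℚ.* ℕ→ℚ (proj₁ (total t)) ≡ ℕ→ℚ (proj₂ (total t))
    eq = /-*-cancel (proj₂ (total t)) (proj₁ (total t))

-- The two bounds for graphs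

upper-bound : ∀ n l → 2 ^ l ≤ n → (T : Graph n) → IsTree T → ∀ μ → MeanSubtreeOrder T μ →
              μ ℚ.≤ ℕ→ℚ n ℚ.- ℕ→ℚ (2 * l) ℚ.+ ℕ→ℚ 30
upper-bound zero    l 2^l≤0 T tree μ mean = contradiction 2^l≤0 (<⇒≱ (m^n>0 2 l))
upper-bound (suc m) l 2^l≤n T tree μ mean =
  -- The 10 of `total-bound` is weakened to the 30 that the batons require.
  mean-upper d (2 * l) 30 (≤-trans bound (*-monoˡ-≤ (proj₁ (total t)) (+-monoʳ-≤ (suc m) (m≤m+n 10 20)))) mean
  where
  t : RTree
  t = proj₁ (tree-decomposition T zero tree)
  d : Decomposition T zero (full (suc m)) t
  d = proj₂ (tree-decomposition T zero tree)
  bound : proj₂ (total t) + 2 * l * proj₁ (total t) ≤ (suc m + 10) * proj₁ (total t)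
  bound = subst (λ n → proj₂ (total t) + 2 * l * proj₁ (total t) ≤ (n + 10) * proj₁ (total t)) (order≡ d)
            (total-bound l t (subst (2 ^ l ≤_) (sym (order≡ d)) 2^l≤n))

lower-bound : ∀ n l → 2 ^ l ≤ n → n < 2 ^ suc l →
  Σ[ T ∈ Graph n ] ∃[ μ ] (IsTree T × MeanSubtreeOrder T μ × ℕ→ℚ n ℚ.- ℕ→ℚ (2 * l) ℚ.- ℕ→ℚ 30 ℚ.≤ μ)
lower-bound n l 2^l≤n n<2^1+l =
  let t , c , order≡n , h = good-caterpillar l n 2^l≤n n<2^1+l
      T , tree , r , d    = caterpillar-tree c order≡n
      μ , mean , bound    = mean-lower d (2 * l) 30 h
  in T , μ , tree , mean , bound

theorem1p1 : ∃[ C ] ((n : ℕ) → 2 ≤ n →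
    ((T : Graph n) → IsTree T → (μ : ℚ) → MeanSubtreeOrder T μ →
    μ ℚ.≤ target n ℚ.+ ℕ→ℚ C)
    × (Σ[ T ∈ Graph n ] ∃[ μ ] (IsTree T × MeanSubtreeOrder T μ
    × target n ℚ.- ℕ→ℚ C ℚ.≤ μ)))
theorem1p1 = 30 , λ n 2≤n →
  let 2^l≤n = 2^⌊log₂n⌋≤n n (≤-trans (n≤1+n 1) 2≤n)
  in upper-bound n ⌊log₂ n ⌋ 2^l≤n , lower-bound n ⌊log₂ n ⌋ 2^l≤n (n<2^[1+⌊log₂n⌋] n)
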